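{- There is an algorithm that solves the problem $F_2||\sum_{J_j\in E} w_j$ (just-in-time flow-shop scheduling on two machines) with $n$ jobs in $O(n2^k)$ time, where $k=\#d\cdot\#p^{(1)}$. Thus, the problem is fixed-parameter tractable when parameterized by combining the number $\#d$ of different due dates with the number $\#p^{(1)}$ of different processing times on the first machine.
   Context: JIT flow-shop problem $F_m||\sum_{J_j\in E}w_j$: an instance consists of $n$ independent, non-preemptive jobs $\mathcal J=\{J_1,\dots,J_n\}$, all available at time $0$, and $m$ machines $M_1,\dots,M_m$. Job $J_j$ has a processing time $p^{(i)}_j$ on each machine $M_i$, a due date $d_j$ and a weight $w_j$; all these numbers are positive integers. Every scheduled job must be processed first on $M_1$, then on $M_2$, and so on up to $M_m$; its processing on $M_i$ cannot start before its processing on $M_{i-1}$ is completed; each machine processes at most one job at a time; idle time and waiting between machines are allowed, and the processing orders on different machines may differ. A job is scheduled in JIT mode if its processing on $M_m$ is completed exactly at time $d_j$. A partition $\mathcal J=E\cup T$ is feasible if the jobs of $E$ can all be scheduled in JIT mode (jobs of $T$ are rejected and are not processed). The goal is to find a feasible partition maximizing $\sum_{J_j\in E}w_j$. $\#d$ is the number of distinct values among the due dates $d_1,\dots,d_n$, and $\#p^{(1)}$ is the number of distinct values among $p^{(1)}_1,\dots,p^{(1)}_n$. Running times count elementary arithmetic operations and comparisons on the input numbers as single steps. A problem is fixed-parameter tractable (FPT) with respect to a parameter $\kappa$ if every instance $I$ can be solved in $f(\kappa)\cdot|I|^{O(1)}$ time for a computable function $f$ depending only on $\kappa$. The combined parameter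 here is $\#d+\#p^{(1)}$. -}

module Defs where

open import Algebra.Properties.CommutativeMonoid.Sum using (sum)
open import Data.Bool using (Bool; true; false; if_then_else_)
open import Data.Fin using (Fin; toℕ; fromℕ<)
open import Data.Fin.Subset using (Subset; _∈_)
open import Data.Integer using (+_)
open import Data.List using (length; deduplicate; tabulate)
open import Data.Nat
  using (ℕ; zero; suc; _+_; _*_; _∸_; _^_; _≤_; _<_; _≟_; _<?_; _<ᵇ_; _≡ᵇ_)
open import Data.Nat.Logarithm using (⌊log₂_⌋)
open import Data.Nat.Properties using (+-0-commutativeMonoid)
open import Data.Product using (Σ; ∃; _×_)
open import Data.Rational as ℚ using (ℚ; 0ℚ)
open import Data.Sum using (_⊎_)
import Data.Vec as Vec
open import Relation.Binary.PropositionalEquality using (_≡_; _≢_)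
open import Relation.Nullary using (yes; no)

infix 5 ∑
∑ : (n : ℕ) → (Fin n → ℕ) → ℕ
∑ n f = sum +-0-commutativeMonoid {n} f
syntax ∑ n (λ i → e) = ∑[ i < n ] e

#distinct : ∀ {n} → (Fin n → ℕ) → ℕ
#distinct f = length (deduplicate _≟_ (tabulate f))

------------------------------------------------------------------------
-- Unit-cost random access machine, programmed by structured commands.
-- There are finitely many registers and arrays per program (those named
-- in its text).  Multiplication is deliberately not primitive: with
-- addition and subtraction only, unit-cost time is polynomially related
-- to Turing machine time.

record State : Set where
  constructor state
  field
    reg : ℕ → ℕ
    arr : ℕ → ℕ → ℕ
open State public

update : {A : Set} → (ℕ → A) → ℕ → A → ℕ → A
update f x v y = if y ≡ᵇ x then v else f y

setReg : State → ℕ → ℕ → State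
setReg σ x v = state (update (reg σ) x v) (arr σ)

setArr : State → ℕ → ℕ → ℕ → State
setArr σ a i v = state (reg σ) (update (arr σ) a (update (arr σ a) i v))

infixl 7 _⊕_ _⊖_
data Expr : Set where
  lit     : ℕ → Expr
  var     : ℕ → Expr
  _[_]    : (a : ℕ) (index : Expr) → Expr
  _⊕_ _⊖_ : Expr → Expr → Expr

infix 6 _≺_ _≈_
data Test : Set where
  _≺_ _≈_ : Expr → Expr → Test

infixr 3 _⨾_
infix  4 _≔_ _[_]≔_
data Cmd : Set where
  skip   : Cmd
  _≔_    : (x : ℕ) → Expr → Cmd
  _[_]≔_ : (a : ℕ) (index value : Expr) → Cmd
  _⨾_    : Cmd → Cmd → Cmd
  ifᶜ    : Test → Cmd → Cmd → Cmd
  while  : Test → Cmd → Cmd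

eval : State → Expr → ℕ
eval σ (lit v)   = v
eval σ (var x)   = reg σ x
eval σ (a [ e ]) = arr σ a (eval σ e)
eval σ (e ⊕ e′)  = eval σ e + eval σ e′
eval σ (e ⊖ e′)  = eval σ e ∸ eval σ e′

test : State → Test → Bool
test σ (e ≺ e′) = eval σ e <ᵇ eval σ e′
test σ (e ≈ e′) = eval σ e ≡ᵇ eval σ e′

cost : Expr → ℕ
cost (lit v)  = 1
cost (var x)  = 1
cost (a [ e ]) = 1 + cost e
cost (e ⊕ e′) = 1 + (cost e + cost e′)
cost (e ⊖ e′) = 1 + (cost e + cost e′)

costᵗ : Test → ℕ
costᵗ (e ≺ e′) = 1 + (cost e + cost e′)
costᵗ (e ≈ e′) = 1 + (cost e + cost e′)

-- ⟨ c , σ ⟩⇓[ t ] σ′ : started in σ, the command c halts in σ′ after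
-- exactly t steps.
infix 3 ⟨_,_⟩⇓[_]_
data ⟨_,_⟩⇓[_]_ : Cmd → State → ℕ → State → Set where
  ⇓skip  : ∀ {σ} → ⟨ skip , σ ⟩⇓[ 1 ] σ
  ⇓reg   : ∀ {σ x e} →
           ⟨ x ≔ e , σ ⟩⇓[ 1 + cost e ] setReg σ x (eval σ e)
  ⇓arr   : ∀ {σ a i e} →
           ⟨ a [ i ]≔ e , σ ⟩⇓[ 1 + (cost i + cost e) ]
             setArr σ a (eval σ i) (eval σ e)
  ⇓seq   : ∀ {σ₁ σ₂ σ₃ c₁ c₂ t₁ t₂} →
           ⟨ c₁ , σ₁ ⟩⇓[ t₁ ] σ₂ → ⟨ c₂ , σ₂ ⟩⇓[ t₂ ] σ₃ →
           ⟨ c₁ ⨾ c₂ , σ₁ ⟩⇓[ t₁ + t₂ ] σ₃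
  ⇓then  : ∀ {σ σ′ b c₁ c₂ t} → test σ b ≡ true →
           ⟨ c₁ , σ ⟩⇓[ t ] σ′ →
           ⟨ ifᶜ b c₁ c₂ , σ ⟩⇓[ 1 + (costᵗ b + t) ] σ′
  ⇓else  : ∀ {σ σ′ b c₁ c₂ t} → test σ b ≡ false →
           ⟨ c₂ , σ ⟩⇓[ t ] σ′ →
           ⟨ ifᶜ b c₁ c₂ , σ ⟩⇓[ 1 + (costᵗ b + t) ] σ′
  ⇓exit  : ∀ {σ b c} → test σ b ≡ false →
           ⟨ while b c , σ ⟩⇓[ 1 + costᵗ b ] σ
  ⇓loop  : ∀ {σ₁ σ₂ σ₃ b c t₁ t₂} → test σ₁ b ≡ true →
           ⟨ c , σ₁ ⟩⇓[ t₁ ] σ₂ → ⟨ while b c , σ₂ ⟩⇓[ t₂ ] σ₃ →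
           ⟨ while b c , σ₁ ⟩⇓[ 1 + (costᵗ b + (t₁ + t₂)) ] σ₃

-- Argument and result are both in register 0.
Computable : (ℕ → ℕ) → Set
Computable f = ∃ λ c → ∀ k → ∃ λ t → ∃ λ σ →
  (⟨ c , state (update (λ _ → 0) 0 k) (λ _ _ → 0) ⟩⇓[ t ] σ) × reg σ 0 ≡ f k

record Problem : Set₁ where
  field
    Instance : Set
    size     : Instance → ℕ
    load     : Instance → State
    Solution : Instance → State → Set

SolvesWithin : (P : Problem) → Cmd → Problem.Instance P → ℕ → Set
SolvesWithin P c I bound = ∃ λ t → ∃ λ σ →
  (⟨ c , load I ⟩⇓[ t ] σ) × t ≤ bound × Solution I σ
  where open Problem P

FPT : (P : Problem) → (Problem.Instance P → ℕ) → Set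
FPT P κ = ∃ λ (c : Cmd) → ∃ λ (f : ℕ → ℕ) → Computable f ×
  ∃ λ (r : ℕ) → ∀ I → SolvesWithin P c I (f (κ I) * Problem.size P I ^ r)

------------------------------------------------------------------------
-- Just-in-time flow shop with m machines

record FlowShop (m : ℕ) : Set where
  field
    n   : ℕ
    p   : Fin m → Fin n → ℕ
    d w : Fin n → ℕ
    n>0 : 0 < n
    p>0 : ∀ i j → 0 < p i j
    d>0 : ∀ j → 0 < d j
    w>0 : ∀ j → 0 < w j

fromℕ : ℕ → ℚ
fromℕ k = + k ℚ./ 1

-- Start times of rejected jobs are meaningless and unconstrained.
record JITSchedule {m} (I : FlowShop m) (E : Subset (FlowShop.n I)) : Set where
  open FlowShop I
  field
    start : Fin m → Fin n → ℚ

  finish : Fin m → Fin n → ℚ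
  finish i j = start i j ℚ.+ fromℕ (p i j)

  field
    available : ∀ i {j} → j ∈ E → 0ℚ ℚ.≤ start i j
    route     : ∀ {i i′} → toℕ i′ ≡ suc (toℕ i) →
                ∀ {j} → j ∈ E → finish i j ℚ.≤ start i′ j
    disjoint  : ∀ i {j j′} → j ∈ E → j′ ∈ E → j ≢ j′ →
                finish i j ℚ.≤ start i j′ ⊎ finish i j′ ℚ.≤ start i j
    jit       : ∀ {i} → suc (toℕ i) ≡ m →
                ∀ {j} → j ∈ E → finish i j ≡ fromℕ (d j)

weight : ∀ {m} (I : FlowShop m) → Subset (FlowShop.n I) → ℕ
weight I E = ∑[ j < n ] (if Vec.lookup E j then w j else 0)
  where open FlowShop I

-- A partition into E and T is represented by E; T is its complement.
Optimal : ∀ {m} (I : FlowShop m) → Subset (FlowShop.n I) → Set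
Optimal I E = JITSchedule I E × (∀ E′ → JITSchedule I E′ → weight I E′ ≤ weight I E)

table : ∀ {n} → (Fin n → ℕ) → ℕ → ℕ
table {n} f x with x <? n
... | yes x<n = f (fromℕ< x<n)
... | no  _   = 0

-- Register 0 holds n; arrays 0, 1, 2, …, m + 1 hold the due dates, the
-- weights and the processing times on the successive machines.  All
-- other memory is 0.
loadFlowShop : ∀ {m} → FlowShop m → State
loadFlowShop {m} I = state (update (λ _ → 0) 0 n) input
  where
  open FlowShop I
  input : ℕ → ℕ → ℕ
  input 0             = table d
  input 1             = table w
  input (suc (suc i)) = table (λ j → table (λ i′ → p i′ j) i)

-- The answer E is returned as its indicator function, in array m + 2.
output : ∀ {m} (I : FlowShop m) → State → Subset (FlowShop.n I)
output {m} I σ = Vec.tabulate λ j → 0 <ᵇ arr σ (2 + m) (toℕ j)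

bits : ℕ → ℕ
bits x = suc ⌊log₂ x ⌋

encodingLength : ∀ {m} → FlowShop m → ℕ
encodingLength {m} I =
  bits n + (∑[ j < n ] (bits (d j) + bits (w j) + (∑[ i < m ] bits (p i j))))
  where open FlowShop I

JITFlowShop : ℕ → Problem
JITFlowShop m = record
  { Instance = FlowShop m
  ; size     = encodingLength
  ; load     = loadFlowShop
  ; Solution = λ I σ → Optimal I (output I σ)
  }

#d : ∀ {m} → FlowShop m → ℕ
#d I = #distinct (FlowShop.d I)

#p : ∀ {m} → Fin m → FlowShop m → ℕ
#p i I = #distinct (FlowShop.p I i)

{-# OPTIONS --safe #-}
module Submission where

open import Defs
open import Data.Fin using (zero)
open import Data.Nat using (ℕ; _+_; _*_; _^_)
open import Data.Product using (∃; _×_)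

open import Data.Bool using (Bool; true; false; T; if_then_else_; _∨_)
open import Data.Bool.Properties using (∨-conicalˡ; ∨-conicalʳ)
open import Data.Fin as Fin using (Fin; suc; toℕ; fromℕ<)
open import Data.Fin.Properties as Fin
  using (toℕ<n; toℕ-fromℕ<; fromℕ<-toℕ; toℕ-injective; any?; injective⇒≤)
open import Data.Fin.Subset using (Subset; _∈_)
open import Data.Fin.Subset.Properties using (_∈?_)
open import Data.Integer as ℤ using () renaming (+_ to int)
import Data.Integer.Properties as ℤ
open import Data.List using (List; []; _∷_; length; lookup; map; tabulate; deduplicate)
import Data.List.Membership.Propositional as List
open import Data.List.Membership.Propositional.Properties
  using (∈-deduplicate⁺; ∈-tabulate⁺; ∈-length)
open import Data.List.Properties using (length-tabulate)
open import Data.List.Relation.Binary.Permutation.Propositional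
  using (_↭_; ↭-refl; ↭-sym; ↭-trans; prep; swap)
open import Data.List.Relation.Binary.Permutation.Propositional.Properties
  using (All-resp-↭; map⁺)
open import Data.List.Relation.Unary.All as All using (All; []; _∷_)
open import Data.List.Relation.Unary.AllPairs using (AllPairs; []; _∷_)
import Data.List.Relation.Unary.Any as Any
open import Data.List.Relation.Unary.Any.Properties using (lookup-index)
open import Data.Nat hiding (_+_; _*_; _^_; ℕ)
open import Data.Nat.ListAction using (sum)
open import Data.Nat.ListAction.Properties using (sum-↭)
open import Data.Nat.Properties
open import Data.Product using (_,_; proj₁; proj₂)
open import Data.Rational as ℚ using (ℚ; 0ℚ; toℚᵘ)
import Data.Rational.Properties as ℚ
open import Data.Rational.Unnormalised as ℚᵘ using (mkℚᵘ; *≡*; *≤*)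
import Data.Rational.Unnormalised.Properties as ℚᵘ
open import Data.Sum using (_⊎_; inj₁; inj₂)
import Data.Vec as Vec
open import Data.Vec.Properties using ([]=⇒lookup; lookup⇒[]=; lookup∘tabulate)
open import Function using (_$_)
open import Relation.Binary.Definitions using (tri<; tri≈; tri>)
open import Relation.Binary.PropositionalEquality
  using (_≡_; _≢_; refl; sym; trans; cong; cong₂; subst; subst₂; module ≡-Reasoning)
open import Relation.Nullary using (¬_; contradiction; yes; no; _×-dec_)

-- A feasible set has at most one job per due date.  Guess, for every due
-- date, the processing time on M₁ of the job completed then, or 0 if there
-- is none: at most (#p + 1) ^ #d ≤ 2 ^ (#d * #p) guesses.  A guess fixes the
-- load of M₁ up to each due date and the previous due date in use, hence
-- which jobs of that processing time fit; the choices for different due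
-- dates are then independent, and a heaviest fitting job is taken for each.
-- One pass over the jobs does this, with tables addressed by due date, and
-- the guesses are enumerated by an odometer.

-- Each guess may cost only O(n) and the preparation only O(n2^k), which for small `k` rules out
-- even comparison-sorting the jobs. Hence the distinct values are listed by repeated linear scans,
-- and a job reaches the data of its due date in constant time because the tables are addressed by
-- the due date itself; a new guess resets only one entry per due date.
--
-- A guess reserves time on M₁ rather than describing a set. If nothing fits at some due date, the
-- reserved time stays idle and the jobs selected elsewhere remain feasible. Conversely, every
-- schedule, with arbitrary rational start times and possibly different orders on the two machines,
-- determines a guess. All of its jobs due no later than a job j have left M₁ when j starts on M₂,
-- and disjoint intervals within that span cannot exceed its length in total. So the conditions read
-- off a guess are necessary as well as sufficient, and both machines may follow the order of the
-- due dates.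

<ᵇ-true : ∀ {a b} → (a <ᵇ b) ≡ true → a < b
<ᵇ-true {a} {b} eq = <ᵇ⇒< a b (subst T (sym eq) _)

<ᵇ-false : ∀ {a b} → (a <ᵇ b) ≡ false → b ≤ a
<ᵇ-false {a} {b} eq = ≮⇒≥ λ a<b → subst T eq (<⇒<ᵇ a<b)

≡ᵇ-true : ∀ {a b} → (a ≡ᵇ b) ≡ true → a ≡ b
≡ᵇ-true {a} {b} eq = ≡ᵇ⇒≡ a b (subst T (sym eq) _)

≡ᵇ-false : ∀ {a b} → (a ≡ᵇ b) ≡ false → a ≢ b
≡ᵇ-false {a} {b} eq a≡b = subst T eq (≡⇒≡ᵇ a b a≡b)

≡ᵇ-refl : ∀ a → (a ≡ᵇ a) ≡ true
≡ᵇ-refl zero    = refl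
≡ᵇ-refl (suc a) = ≡ᵇ-refl a

≢⇒≡ᵇ-false : ∀ {a b} → a ≢ b → (a ≡ᵇ b) ≡ false
≢⇒≡ᵇ-false {a} {b} a≢b with a ≡ᵇ b in eq
... | true  = contradiction (≡ᵇ-true eq) a≢b
... | false = refl

update-≡ : ∀ {A : Set} (f : ℕ → A) {x y v} → y ≡ x → update f x v y ≡ v
update-≡ f {x} refl rewrite ≡ᵇ-refl x = refl

update-false : ∀ {A : Set} (f : ℕ → A) x {y v} → (y ≡ᵇ x) ≡ false → update f x v y ≡ f y
update-false f x e rewrite e = refl

update-≢ : ∀ {A : Set} (f : ℕ → A) {x y v} → y ≢ x → update f x v y ≡ f y
update-≢ f y≢x = update-false f _ (≢⇒≡ᵇ-false y≢x)

-- Program logic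

-- The tests are Boolean, so that for a concrete command every claim that it leaves some memory
-- alone holds by `refl`.
writesᵣ writesₐ : Cmd → ℕ → Bool
writesᵣ skip         y = false
writesᵣ (x ≔ _)      y = y ≡ᵇ x
writesᵣ (_ [ _ ]≔ _) y = false
writesᵣ (c ⨾ c′)     y = writesᵣ c y ∨ writesᵣ c′ y
writesᵣ (ifᶜ _ c c′) y = writesᵣ c y ∨ writesᵣ c′ y
writesᵣ (while _ c)  y = writesᵣ c y
writesₐ skip         b = false
writesₐ (_ ≔ _)      b = false
writesₐ (a [ _ ]≔ _) b = b ≡ᵇ a
writesₐ (c ⨾ c′)     b = writesₐ c b ∨ writesₐ c′ b
writesₐ (ifᶜ _ c c′) b = writesₐ c b ∨ writesₐ c′ b
writesₐ (while _ c)  b = writesₐ c b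

record Frame (c : Cmd) (σ σ′ : State) : Set where
  constructor frame
  field
    onReg : ∀ x → writesᵣ c x ≡ false → reg σ′ x ≡ reg σ x
    onArr : ∀ a → writesₐ c a ≡ false → arr σ′ a ≡ arr σ a
open Frame

Frame-refl : ∀ {c σ} → Frame c σ σ
Frame-refl = frame (λ _ _ → refl) (λ _ _ → refl)

Frame-trans : ∀ {c σ₁ σ₂ σ₃} → Frame c σ₁ σ₂ → Frame c σ₂ σ₃ → Frame c σ₁ σ₃
Frame-trans f g = frame (λ x e → trans (onReg g x e) (onReg f x e))
                        (λ a e → trans (onArr g a e) (onArr f a e))

Frame-⊆ : ∀ {c c′ σ σ′} → (∀ x → writesᵣ c′ x ≡ false → writesᵣ c x ≡ false) →
          (∀ a → writesₐ c′ a ≡ false → writesₐ c a ≡ false) →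
          Frame c σ σ′ → Frame c′ σ σ′
Frame-⊆ r a f = frame (λ x e → onReg f x (r x e)) (λ x e → onArr f x (a x e))

Frame-ˡ : ∀ {c σ σ′} c′ → Frame c σ σ′ → Frame (c ⨾ c′) σ σ′
Frame-ˡ {c} c′ = Frame-⊆ (λ _ → ∨-conicalˡ _ _) (λ _ → ∨-conicalˡ _ _)

Frame-ʳ : ∀ {c′ σ σ′} c → Frame c′ σ σ′ → Frame (c ⨾ c′) σ σ′
Frame-ʳ {c′} c = Frame-⊆ (λ x → ∨-conicalʳ (writesᵣ c x) _) (λ a → ∨-conicalʳ (writesₐ c a) _)

⇓-frame : ∀ {c σ t σ′} → ⟨ c , σ ⟩⇓[ t ] σ′ → Frame c σ σ′
⇓-frame ⇓skip = Frame-refl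
⇓-frame (⇓reg {σ} {x}) = frame (λ _ → update-false (reg σ) x) (λ _ _ → refl)
⇓-frame (⇓arr {σ} {a}) = frame (λ _ _ → refl) (λ _ → update-false (arr σ) a)
⇓-frame (⇓seq {c₁ = c₁} {c₂ = c₂} p q) =
  Frame-trans (Frame-ˡ c₂ (⇓-frame p)) (Frame-ʳ c₁ (⇓-frame q))
⇓-frame (⇓then {c₁ = c₁} {c₂ = c₂} _ p) = Frame-⊆ (λ _ → ∨-conicalˡ _ _) (λ _ → ∨-conicalˡ _ _) (⇓-frame p)
⇓-frame (⇓else {c₁ = c₁} {c₂ = c₂} _ p) =
  Frame-⊆ (λ x → ∨-conicalʳ (writesᵣ c₁ x) _) (λ a → ∨-conicalʳ (writesₐ c₁ a) _) (⇓-frame p)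
⇓-frame (⇓exit _) = Frame-refl
⇓-frame (⇓loop {b = b} {c = c} _ p q) =
  Frame-trans (Frame-⊆ {c} {while b c} (λ _ e → e) (λ _ e → e) (⇓-frame p)) (⇓-frame q)

-- The body of a loop counts once: the number of rounds is left to the factor `M` of `Run`. Both
-- branches of a conditional are added, which covers either outcome.
unit : Cmd → ℕ
unit skip         = 1
unit (_ ≔ e)      = 1 + cost e
unit (_ [ i ]≔ e) = 1 + (cost i + cost e)
unit (c ⨾ c′)     = unit c + unit c′
unit (ifᶜ b c c′) = 1 + (costᵗ b + (unit c + unit c′))
unit (while b c)  = 1 + (costᵗ b + unit c)

-- The time bound is M up to the constant unit c, which depends on the text
-- of c only; this makes bounds compose without tracking constants.
record Run (M : ℕ) (c : Cmd) (σ : State) (Q : State → Set) : Set where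
  constructor run
  field
    {steps} : ℕ
    {final} : State
    halts   : ⟨ c , σ ⟩⇓[ steps ] final
    fast    : steps ≤ unit c * M
    post    : Q final

module _ {M : ℕ} .{{_ : NonZero M}} where

  runSkip : ∀ {σ Q} → Q σ → Run M skip σ Q
  runSkip q = run ⇓skip (m≤m*n 1 M) q

  runReg : ∀ {σ x e Q} → Q (setReg σ x (eval σ e)) → Run M (x ≔ e) σ Q
  runReg {e = e} q = run ⇓reg (m≤m*n (1 + cost e) M) q

  runArr : ∀ {σ a i e Q} → Q (setArr σ a (eval σ i) (eval σ e)) → Run M (a [ i ]≔ e) σ Q
  runArr {i = i} {e} q = run ⇓arr (m≤m*n (1 + (cost i + cost e)) M) q

  runSeq : ∀ {c c′ σ Q} → Run M c σ (λ σ′ → Run M c′ σ′ Q) → Run M (c ⨾ c′) σ Q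
  runSeq {c} {c′} (run h f (run h′ f′ q)) =
    run (⇓seq h h′) (≤-trans (+-mono-≤ f f′) (≤-reflexive (sym (*-distribʳ-+ M (unit c) (unit c′))))) q

  private
    branch : ∀ a {t u v} → t ≤ u * M → u ≤ v → suc a + t ≤ suc (a + v) * M
    branch a {t} {u} {v} t≤ u≤v = begin
      suc a + t          ≤⟨ +-mono-≤ (m≤m*n (suc a) M) (≤-trans t≤ (*-monoˡ-≤ M u≤v)) ⟩
      suc a * M + v * M  ≡⟨ *-distribʳ-+ M (suc a) v ⟨
      suc (a + v) * M    ∎
      where open ≤-Reasoning

  runIf : ∀ {σ b c c′ Q} → (test σ b ≡ true → Run M c σ Q) → (test σ b ≡ false → Run M c′ σ Q) →
          Run M (ifᶜ b c c′) σ Q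
  runIf {σ} {b} {c} {c′} onTrue onFalse with test σ b in eq
  ... | true with onTrue refl
  ...   | run h f q = run (⇓then eq h) (branch (costᵗ b) {u = unit c} f (m≤m+n (unit c) (unit c′))) q
  runIf {σ} {b} {c} {c′} onTrue onFalse | false with onFalse refl
  ...   | run h f q = run (⇓else eq h) (branch (costᵗ b) {u = unit c′} f (m≤n+m (unit c′) (unit c))) q

  -- The index of `Inv` bounds the remaining rounds: whenever the test succeeds, `step` has to
  -- exhibit a predecessor, and this gives termination. The additional `M` in `suc fuel * M` pays
  -- for the failing test at the end. The frame handed to `step` keeps memory that the body does not
  -- write out of the invariants.
  runWhile : ∀ {M′ b c σ₀} (Inv : ℕ → State → Set) fuel → suc fuel * M ≤ M′ → Inv fuel σ₀ →
             (∀ k σ → Frame c σ₀ σ → test σ b ≡ true → Inv k σ →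
                ∃ λ k′ → k ≡ suc k′ × Run M c σ (Inv k′)) →
             Run M′ (while b c) σ₀ (λ σ → Frame c σ₀ σ × test σ b ≡ false × ∃ λ k → Inv k σ)
  runWhile {M′} {b} {c} {σ₀} Inv fuel ≤M′ inv₀ step = weaken (loop fuel σ₀ Frame-refl inv₀)
    where
    Q : State → Set
    Q σ = Frame c σ₀ σ × test σ b ≡ false × ∃ λ k → Inv k σ

    weaken : Run (suc fuel * M) (while b c) σ₀ Q → Run M′ (while b c) σ₀ Q
    weaken (run h f q) = run h (≤-trans f (*-monoʳ-≤ (unit (while b c)) ≤M′)) q

    once : ∀ {t} → t ≤ unit c * M → suc (costᵗ b + t) ≤ unit (while b c) * M
    once f = branch (costᵗ b) {u = unit c} f ≤-refl

    loop : ∀ k σ → Frame c σ₀ σ → Inv k σ → Run (suc k * M) (while b c) σ Q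
    loop k σ fr inv with test σ b in eq
    ... | false = run (⇓exit eq) exit≤ (fr , eq , k , inv)
      where
      exit≤ : 1 + costᵗ b ≤ unit (while b c) * (suc k * M)
      exit≤ = begin
        1 + costᵗ b                    ≤⟨ s≤s (m≤m+n _ 0) ⟩
        suc (costᵗ b + 0)              ≤⟨ once z≤n ⟩
        unit (while b c) * M           ≤⟨ *-monoʳ-≤ (unit (while b c)) (m≤m+n M (k * M)) ⟩
        unit (while b c) * (suc k * M) ∎
        where open ≤-Reasoning
    ... | true with step k σ fr eq inv
    ...   | k′ , refl , run {t} {σ′} h f inv′
            with loop k′ σ′ (Frame-trans fr (⇓-frame h)) inv′
    ...     | run {t′} h′ f′ q = run (⇓loop eq h h′) loop≤ q
      where
      U = unit (while b c)
      loop≤ : suc (costᵗ b + (t + t′)) ≤ U * (M + suc k′ * M)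
      loop≤ = begin
        suc (costᵗ b + (t + t′))  ≡⟨ cong suc (+-assoc (costᵗ b) t t′) ⟨
        suc (costᵗ b + t) + t′    ≤⟨ +-mono-≤ (once f) f′ ⟩
        U * M + U * (suc k′ * M)  ≡⟨ *-distribˡ-+ U M (suc k′ * M) ⟨
        U * (M + suc k′ * M)      ∎
        where open ≤-Reasoning

weakenTime : ∀ {M M′ c σ Q} → M ≤ M′ → Run M c σ Q → Run M′ c σ Q
weakenTime {c = c} M≤M′ (run h f q) = run h (≤-trans f (*-monoʳ-≤ (unit c) M≤M′)) q

conseq : ∀ {M c σ} {Q Q′ : State → Set} →
         (∀ {σ′} → Frame c σ σ′ → Q σ′ → Q′ σ′) → Run M c σ Q → Run M c σ Q′
conseq k (run h f q) = run h f (k (⇓-frame h) q)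

infixr 2 _∙>_
_∙>_ : ∀ {M c c′ σ} {Q Q′ : State → Set} .{{_ : NonZero M}} → Run M c σ Q →
       (∀ {σ′} → Frame c σ σ′ → Q σ′ → Run M c′ σ′ Q′) → Run M (c ⨾ c′) σ Q′
r ∙> k = runSeq (conseq k r)

for : ℕ → ℕ → Cmd → Cmd
for x y c = x ≔ lit 0 ⨾ while (var x ≺ var y) (c ⨾ x ≔ var x ⊕ lit 1)

-- The counter is advanced outside `c`, so `step` establishes the invariant in the state whose
-- counter is already `suc k`. For an invariant about other concrete registers this `setReg`
-- computes away.
runFor : ∀ {M M′ x y c σ₀} .{{_ : NonZero M}} .{{_ : NonZero M′}} {N} (J : ℕ → State → Set) →
         writesᵣ c x ≡ false → writesᵣ c y ≡ false → (y ≡ᵇ x) ≡ false →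
         reg σ₀ y ≡ N → suc N * M ≤ M′ →
         J 0 (setReg σ₀ x 0) →
         (∀ k σ → k < N → Frame (for x y c) σ₀ σ → reg σ x ≡ k → J k σ →
            Run M c σ (λ σ′ → J (suc k) (setReg σ′ x (suc k)))) →
         Run M′ (for x y c) σ₀ (J N)
runFor {M} {M′} {x} {y} {c} {σ₀} {N} J wx wy y≢x σy ≤M′ j₀ step =
  runSeq (runReg (conseq finish (runWhile Inv N ≤M′ inv₀ body)))
  where
  σ₁ = setReg σ₀ x 0
  loopBody = c ⨾ x ≔ var x ⊕ lit 1
  Inv : ℕ → State → Set
  Inv k σ = reg σ x + k ≡ N × J (reg σ x) σ

  σ₁y : reg σ₁ y ≡ N
  σ₁y rewrite y≢x = σy

  loop-y : writesᵣ loopBody y ≡ false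
  loop-y rewrite wy = y≢x

  inv₀ : Inv N σ₁
  inv₀ rewrite ≡ᵇ-refl x = refl , j₀

  frame₁ : ∀ {σ} → Frame loopBody σ₁ σ → Frame (for x y c) σ₀ σ
  frame₁ fr = Frame-trans
    (frame (λ z e → update-false (reg σ₀) x (∨-conicalˡ (z ≡ᵇ x) _ e)) (λ _ _ → refl))
    (Frame-ʳ (x ≔ lit 0) (Frame-⊆ (λ _ e → e) (λ _ e → e) fr))

  finish : ∀ {σ} → Frame (while (var x ≺ var y) loopBody) σ₁ σ →
           Frame loopBody σ₁ σ × test σ (var x ≺ var y) ≡ false × (∃ λ k → Inv k σ) → J N σ
  finish {σ} _ (fr , stop , k , eq , j) = subst (λ i → J i σ) (≤-antisym x≤N N≤x) j
    where
    x≤N : reg σ x ≤ N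
    x≤N = subst (reg σ x ≤_) eq (m≤m+n _ k)
    N≤x : N ≤ reg σ x
    N≤x = subst (_≤ reg σ x) (trans (onReg fr y loop-y) σ₁y) (<ᵇ-false stop)

  body : ∀ k σ → Frame loopBody σ₁ σ → test σ (var x ≺ var y) ≡ true → Inv k σ →
         ∃ λ k′ → k ≡ suc k′ × Run M loopBody σ (Inv k′)
  body zero σ fr go (eq , j) = contradiction
    (subst₂ _<_ (trans (sym (+-identityʳ _)) eq) (trans (onReg fr y loop-y) σ₁y) (<ᵇ-true go)) (<-irrefl refl)
  body (suc k) σ fr go (eq , j) = k , refl ,
    (step (reg σ x) σ x<N (frame₁ fr) refl j ∙> λ {σ′} fr′ j′ →
      runReg (next σ′ (onReg fr′ x wx) j′))
    where
    x<N : reg σ x < N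
    x<N = subst (reg σ x <_) (trans (onReg fr y loop-y) σ₁y) (<ᵇ-true go)
    next : ∀ σ′ → reg σ′ x ≡ reg σ x → J (suc (reg σ x)) (setReg σ′ x (suc (reg σ x))) →
           Inv k (setReg σ′ x (reg σ′ x + 1))
    next σ′ e j′ rewrite e | ≡ᵇ-refl x | +-comm (reg σ x) 1 = trans (sym (+-suc _ k)) eq , j′

-- Memory layout

#n #j #m #c #D #q #i #t #prev #tot #best : ℕ
#n = 0
#j = 1
#m = 2
#c = 3
#D = 4
#q = 5
#i = 6
#t = 7
#prev = 8
#tot = 9
#best = 10

-- Arrays 0 to 4 are dictated by the input and output conventions, 4 being `2 + m`; all arrays from
-- 4 on are 0 at the start.
$due $wt $p₁ $p₂ $out $dues $procs $digit $sel $ready $top $pick : ℕ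
$due = 0
$wt = 1
$p₁ = 2
$p₂ = 3
$out = 4
$dues = 5
$procs = 6
$digit = 7
$sel = 8
$ready = 9
$top = 10
$pick = 11

-- Listing the distinct values of an array in increasing order

∀<-suc : ∀ {k} {P : ℕ → Set} → (∀ j → j < k → P j) → P k → ∀ j → j < suc k → P j
∀<-suc h p j j<1+k with m<1+n⇒m<n∨m≡n j<1+k
... | inj₁ j<k  = h j j<k
... | inj₂ refl = p

-- m = 0 encodes that none of the first k values of f exceeds cur.
Least : (f : ℕ → ℕ) (n k cur m : ℕ) → Set
Least f n k cur m =
  (m ≡ 0 × (∀ j → j < k → f j ≤ cur)) ⊎
  (cur < m × (∃ λ j → j < n × f j ≡ m) × (∀ j → j < k → cur < f j → m ≤ f j))

module _ {f : ℕ → ℕ} {n k cur m : ℕ} where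

  least-skip : Least f n k cur m → f k ≤ cur → Least f n (suc k) cur m
  least-skip (inj₁ (e , h)) f≤ = inj₁ (e , ∀<-suc h f≤)
  least-skip (inj₂ (l , w , h)) f≤ = inj₂ (l , w , ∀<-suc h λ c<f → contradiction c<f (≤⇒≯ f≤))

  least-keep : Least f n k cur m → m ≢ 0 → m ≤ f k → Least f n (suc k) cur m
  least-keep (inj₁ (e , _)) m≢0 _ = contradiction e m≢0
  least-keep (inj₂ (l , w , h)) _ m≤f = inj₂ (l , w , ∀<-suc h λ _ → m≤f)

  least-new : Least f n k cur m → k < n → cur < f k → m ≡ 0 ⊎ f k < m → Least f n (suc k) cur (f k)
  least-new (inj₁ (e , h)) k<n c<f _ =
    inj₂ (c<f , (k , k<n , refl) , ∀<-suc (λ j j<k c<fj → contradiction c<fj (≤⇒≯ (h j j<k))) λ _ → ≤-refl)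
  least-new (inj₂ (c<m , w , h)) k<n c<f (inj₁ refl) = contradiction c<m λ()
  least-new (inj₂ (c<m , w , h)) k<n c<f (inj₂ f<m) =
    inj₂ (c<f , (k , k<n , refl) , ∀<-suc (λ j j<k c<fj → ≤-trans (<⇒≤ f<m) (h j j<k c<fj)) λ _ → ≤-refl)

-- Array `b` holds the values listed so far, the last one at index `#c`. Its entry 0 is 0, a
-- threshold below every positive value, so the first scan is no special case.
scan : ℕ → ℕ → Cmd
scan a b = #m ≔ lit 0 ⨾
  for #j #n
    (ifᶜ (b [ var #c ] ≺ a [ var #j ])
      (ifᶜ (var #m ≈ lit 0)
        (#m ≔ a [ var #j ])
        (ifᶜ (a [ var #j ] ≺ var #m) (#m ≔ a [ var #j ]) skip))
      skip)

runScan : ∀ a b σ → Run (suc (reg σ #n)) (scan a b) σ λ σ′ →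
  Least (arr σ a) (reg σ #n) (reg σ #n) (arr σ b (reg σ #c)) (reg σ′ #m)
runScan a b σ = runSeq (runReg
  (runFor J refl refl refl refl (≤-reflexive (*-identityʳ _)) (inj₁ (refl , λ _ ())) step))
  where
  n = reg σ #n
  f = arr σ a
  cur = arr σ b (reg σ #c)
  J : ℕ → State → Set
  J k σ′ = Least f n k cur (reg σ′ #m)
  step : ∀ k σ′ → k < n → Frame _ (setReg σ #m 0) σ′ → reg σ′ #j ≡ k → J k σ′ → Run 1 _ σ′ _
  step k σ′ k<n fr refl l = runIf
    (λ above → let c<f = subst₂ _<_ cur≡ f≡ (<ᵇ-true above) in runIf
      (λ m≡0 → runReg (new c<f (inj₁ (≡ᵇ-true m≡0))))
      (λ m≢0 → runIf
        (λ below → runReg (new c<f (inj₂ (subst (_< reg σ′ #m) f≡ (<ᵇ-true below)))))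
        (λ notBelow → runSkip (least-keep l (≡ᵇ-false m≢0) (subst (reg σ′ #m ≤_) f≡ (<ᵇ-false notBelow))))))
    (λ notAbove → runSkip (least-skip l (subst₂ _≤_ f≡ cur≡ (<ᵇ-false notAbove))))
    where
    cur≡ : arr σ′ b (reg σ′ #c) ≡ cur
    cur≡ = cong₂ (λ g x → g x) (onArr fr b refl) (onReg fr #c refl)
    f≡ : arr σ′ a k ≡ f k
    f≡ = cong (λ g → g k) (onArr fr a refl)
    new : cur < f k → reg σ′ #m ≡ 0 ⊎ f k < reg σ′ #m → Least f n (suc k) cur (arr σ′ a k)
    new c<f h = subst (Least f n (suc k) cur) (sym f≡) (least-new l k<n c<f h)

-- `covers` speaks only of values up to `g c`, so a list still under construction is an enumeration
-- too and can serve as loop invariant. Index 0 is the threshold of the first scan and, for the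
-- processing times, the code for the absence of a job.
record Enumeration (f : ℕ → ℕ) (n c : ℕ) (g : ℕ → ℕ) : Set where
  field
    base   : g 0 ≡ 0
    incr   : ∀ i → i < c → g i < g (suc i)
    from   : ∀ i → i < c → ∃ λ j → j < n × f j ≡ g (suc i)
    covers : ∀ j → j < n → f j ≤ g c → ∃ λ i → i < c × f j ≡ g (suc i)

appendLeast distinct : ℕ → ℕ → Cmd
appendLeast a b = #c ≔ var #c ⊕ lit 1 ⨾ b [ var #c ]≔ var #m ⨾ scan a b
distinct a b = #c ≔ lit 0 ⨾ scan a b ⨾ while (lit 0 ≺ var #m) (appendLeast a b)

enumeration-extend : ∀ {f n c g m} → Enumeration f n c g → Least f n n (g c) m → 0 < m →
                     Enumeration f n (suc c) (update g (suc c) m)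
enumeration-extend E (inj₁ (refl , _)) ()
enumeration-extend {f} {n} {c} {g} {m} E (inj₂ (c<m , (j₀ , j₀<n , f≡m) , min)) _ = record
  { base   = base
  ; incr   = ∀<-suc (λ i i<c → subst₂ _<_ (sym (old (<⇒≤ i<c))) (sym (old i<c)) (incr i i<c))
                    (subst₂ _<_ (sym (old ≤-refl)) (sym new) c<m)
  ; from   = ∀<-suc (λ i i<c → let j , j<n , e = from i i<c in j , j<n , trans e (sym (old i<c)))
                    (j₀ , j₀<n , trans f≡m (sym new))
  ; covers = λ j j<n f≤ → cover j j<n (subst (f j ≤_) new f≤)
  }
  where
  open Enumeration E
  g′ = update g (suc c) m
  new : g′ (suc c) ≡ m
  new = update-≡ g {suc c} refl
  old : ∀ {i} → i ≤ c → g′ i ≡ g i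
  old i≤c = update-≢ g (<⇒≢ (s≤s i≤c))
  cover : ∀ j → j < n → f j ≤ m → ∃ λ i → i < suc c × f j ≡ g′ (suc i)
  cover j j<n f≤m with f j ≤? g c
  ... | yes f≤c = let i , i<c , e = covers j j<n f≤c in i , m<n⇒m<1+n i<c , trans e (sym (old i<c))
  ... | no f≰c  = c , ≤-refl , trans (≤-antisym f≤m (min j j<n (≰⇒> f≰c))) (sym new)

-- The number of rounds is bounded by counting: a test that succeeds after `K` values would extend
-- the list to an enumeration of `suc K` values, against `bound`.
runDistinct : ∀ {M} .{{_ : NonZero M}} {f n} a b σ K →
  arr σ a ≡ f → reg σ #n ≡ n → (a ≡ᵇ b) ≡ false → arr σ b 0 ≡ 0 →
  (∀ j → j < n → 0 < f j) →
  (∀ c g → Enumeration f n c g → c ≤ K) →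
  suc K * suc n ≤ M →
  Run M (distinct a b) σ λ σ′ →
    Enumeration f n (reg σ′ #c) (arr σ′ b) ×
    (∀ j → j < n → f j ≤ arr σ′ b (reg σ′ #c))
runDistinct {M} a b σ K refl refl a≢b b₀ pos bound ≤M = runSeq (runReg
  (weakenTime (≤-trans (m≤m+n _ _) ≤M) (runScan a b σ₁) ∙> λ fr l →
   conseq (λ _ → finish) (runWhile Inv K ≤M (inv₀ fr l) (step fr))))
  where
  σ₁ = setReg σ #c 0
  n = reg σ #n
  f = arr σ a
  Inv : ℕ → State → Set
  Inv k σ′ = k + reg σ′ #c ≡ K × Enumeration f n (reg σ′ #c) (arr σ′ b) ×
             Least f n n (arr σ′ b (reg σ′ #c)) (reg σ′ #m)

  inv₀ : ∀ {σ₂} → Frame (scan a b) σ₁ σ₂ → Least f n n (arr σ b 0) (reg σ₂ #m) → Inv K σ₂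
  inv₀ {σ₂} fr l rewrite onReg fr #c refl | onArr fr b refl =
    +-identityʳ K , empty , l
    where
    empty : Enumeration f n 0 (arr σ b)
    empty = record
      { base = b₀ ; incr = λ _ () ; from = λ _ ()
      ; covers = λ j j<n f≤ → contradiction (pos j j<n) (≤⇒≯ (subst (f j ≤_) b₀ f≤)) }

  step : ∀ {σ₂} → Frame (scan a b) σ₁ σ₂ → ∀ k σ′ → Frame (appendLeast a b) σ₂ σ′ →
         test σ′ (lit 0 ≺ var #m) ≡ true → Inv k σ′ →
         ∃ λ k′ → k ≡ suc k′ × Run (suc n) (appendLeast a b) σ′ (Inv k′)
  step {σ₂} fr₂ k σ′ fr go (eq , E , l) = lemma k eq
    where
    c = reg σ′ #c
    E′ = enumeration-extend E l (<ᵇ-true go)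
    σ″ = setArr (setReg σ′ #c (c + 1)) b (c + 1) (reg σ′ #m)
    n≡ : reg σ′ #n ≡ n
    n≡ = trans (onReg fr #n refl) (onReg fr₂ #n refl)
    f≡ : arr σ″ a ≡ f
    f≡ = trans (update-false (arr σ′) b a≢b)
               (trans (onArr fr a (a≢b′)) (onArr fr₂ a refl))
      where
      a≢b′ : writesₐ (appendLeast a b) a ≡ false
      a≢b′ = cong (_∨ false) a≢b
    b≡ : arr σ″ b ≡ update (arr σ′ b) (suc c) (reg σ′ #m)
    b≡ = trans (update-≡ (arr σ′) {b} refl) (cong (λ i → update (arr σ′ b) i (reg σ′ #m)) (+-comm c 1))
    lemma : ∀ k → k + c ≡ K → ∃ λ k′ → k ≡ suc k′ × Run (suc n) (appendLeast a b) σ′ (Inv k′)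
    lemma zero eq = contradiction (bound _ _ E′) (<⇒≱ (s≤s (≤-reflexive (sym eq))))
    lemma (suc k) eq = k , refl , runSeq (runReg (runSeq (runArr
      (conseq (λ fr′ l′ → inv fr′ l′) (subst (λ N → Run (suc N) (scan a b) σ″ Post) n≡ (runScan a b σ″))))))
      where
      Post : State → Set
      Post σ₃ = Least (arr σ″ a) (reg σ″ #n) (reg σ″ #n) (arr σ″ b (c + 1)) (reg σ₃ #m)
      inv : ∀ {σ₃} → Frame (scan a b) σ″ σ₃ → Post σ₃ → Inv k σ₃
      inv fr′ l′ rewrite f≡ | n≡ | onReg fr′ #c refl | onArr fr′ b refl | b≡ | +-comm c 1 =
        trans (+-suc k c) eq , E′ , l′

  finish : ∀ {σ₂ σ′} → Frame (appendLeast a b) σ₂ σ′ × test σ′ (lit 0 ≺ var #m) ≡ false × (∃ λ k → Inv k σ′) →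
    Enumeration f n (reg σ′ #c) (arr σ′ b) × (∀ j → j < n → f j ≤ arr σ′ b (reg σ′ #c))
  finish (_ , stop , _ , _ , E , inj₁ (_ , h)) = E , h
  finish (_ , stop , _ , _ , E , inj₂ (l , _)) = contradiction (<-≤-trans l (<ᵇ-false stop)) λ()

enumeration-< : ∀ {f n c g} → Enumeration f n c g → ∀ {i i′} → i < i′ → i′ ≤ c → g i < g i′
enumeration-< E {i} {suc i′} i<1+i′ i′<c with m<1+n⇒m<n∨m≡n i<1+i′
... | inj₁ i<i′ = <-trans (enumeration-< E i<i′ (<⇒≤ i′<c)) (Enumeration.incr E i′ i′<c)
... | inj₂ refl = Enumeration.incr E i′ i′<c

enumeration-injective : ∀ {f n c g} → Enumeration f n c g →
  ∀ {i i′} → i ≤ c → i′ ≤ c → g i ≡ g i′ → i ≡ i′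
enumeration-injective E {i} {i′} i≤c i′≤c eq with <-cmp i i′
... | tri< l _ _ = contradiction eq (<⇒≢ (enumeration-< E l i′≤c))
... | tri≈ _ e _ = e
... | tri> _ _ l = contradiction (sym eq) (<⇒≢ (enumeration-< E l i≤c))

-- Finite sums

sumTo : ℕ → (ℕ → ℕ) → ℕ
sumTo zero    f = 0
sumTo (suc k) f = sumTo k f + f k

sumTo-cong : ∀ k {f f′} → (∀ j → j < k → f j ≡ f′ j) → sumTo k f ≡ sumTo k f′
sumTo-cong zero    h = refl
sumTo-cong (suc k) h = cong₂ _+_ (sumTo-cong k λ j j<k → h j (m<n⇒m<1+n j<k)) (h k ≤-refl)

sumTo-remove : ∀ k f {j} → j < k → sumTo k f ≡ sumTo k (update f j 0) + f j
sumTo-remove (suc k) f {j} j<1+k with m<1+n⇒m<n∨m≡n j<1+k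
... | inj₂ refl = cong (_+ f j) (begin
  sumTo j f                     ≡⟨ sumTo-cong j (λ i i<j → sym (update-≢ f (<⇒≢ i<j))) ⟩
  sumTo j f′                    ≡⟨ +-identityʳ _ ⟨
  sumTo j f′ + 0                ≡⟨ cong (sumTo j f′ +_) (update-≡ f {j} refl) ⟨
  sumTo j f′ + f′ j             ∎)
  where open ≡-Reasoning
        f′ = update f j 0
... | inj₁ j<k = begin
  sumTo k f + f k               ≡⟨ cong₂ _+_ (sumTo-remove k f j<k) (sym (update-≢ f (>⇒≢ j<k))) ⟩
  sumTo k f′ + f j + f′ k       ≡⟨ +-assoc (sumTo k f′) (f j) (f′ k) ⟩
  sumTo k f′ + (f j + f′ k)     ≡⟨ cong (sumTo k f′ +_) (+-comm (f j) (f′ k)) ⟩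
  sumTo k f′ + (f′ k + f j)     ≡⟨ +-assoc (sumTo k f′) (f′ k) (f j) ⟨
  sumTo k f′ + f′ k + f j       ∎
  where open ≡-Reasoning
        f′ = update f j 0

-- The dominating index keeps the class, and nonzero summands of `u` have different classes, so no
-- summand of `v` is used twice. The induction sets a used summand of `v` to 0 instead of deleting
-- its index.
sumTo-dominated : ∀ m n (u v cls : ℕ → ℕ) →
  (∀ j → j < m → u j ≢ 0 → ∃ λ j′ → j′ < n × cls j ≡ cls j′ × u j ≤ v j′) →
  (∀ j j′ → j < m → j′ < m → u j ≢ 0 → u j′ ≢ 0 → cls j ≡ cls j′ → j ≡ j′) →
  sumTo m u ≤ sumTo n v
sumTo-dominated zero    n u v cls dom inj = z≤n
sumTo-dominated (suc m) n u v cls dom inj with u m ≟ 0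
... | yes u≡0 = subst (_≤ sumTo n v) (trans (sym (+-identityʳ _)) (cong (sumTo m u +_) (sym u≡0)))
  (sumTo-dominated m n u v cls (λ j j<m → dom j (m<n⇒m<1+n j<m))
    λ j j′ j<m j′<m → inj j j′ (m<n⇒m<1+n j<m) (m<n⇒m<1+n j′<m))
... | no u≢0 with dom m ≤-refl u≢0
...   | i , i<n , m~i , um≤vi = subst (sumTo m u + u m ≤_) (sym (sumTo-remove n v i<n))
  (+-mono-≤ (sumTo-dominated m n u (update v i 0) cls dom′
    λ j j′ j<m j′<m → inj j j′ (m<n⇒m<1+n j<m) (m<n⇒m<1+n j′<m)) um≤vi)
  where
  dom′ : ∀ j → j < m → u j ≢ 0 → ∃ λ j′ → j′ < n × cls j ≡ cls j′ × u j ≤ update v i 0 j′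
  dom′ j j<m uj≢0 with dom j (m<n⇒m<1+n j<m) uj≢0
  ... | j′ , j′<n , j~j′ , uj≤ = j′ , j′<n , j~j′ ,
    subst (u j ≤_) (sym (update-≢ v λ { refl → <⇒≢ j<m
      (inj j m (m<n⇒m<1+n j<m) ≤-refl uj≢0 u≢0 (trans j~j′ (sym m~i))) })) uj≤

-- Selections compatible with a guess

-- The due dates in increasing order are dues 1, …, dues D.  A guess g
-- assigns to dues (suc i) the processing time procs (g i) on M₁ of the job
-- completed then; procs 0 = 0 means that there is no such job.

module Guessing (n D : ℕ) (due wt p₁ p₂ dues procs : ℕ → ℕ) where

  load lastDue : (ℕ → ℕ) → ℕ → ℕ
  load g zero    = 0
  load g (suc i) = load g i + procs (g i)
  lastDue g zero    = 0
  lastDue g (suc i) = if 0 <ᵇ procs (g i) then dues (suc i) else lastDue g i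

  -- A job that completes on M₂ at its due date must start there `p₂ j` earlier. By then its own
  -- work on M₁, included in `load g (suc i)`, and the previous job on M₂ must be over. Sums replace
  -- the difference `due j ∸ p₂ j`, which could truncate.
  Eligible : (ℕ → ℕ) → ℕ → Set
  Eligible g j = ∃ λ i → i < D × due j ≡ dues (suc i) × p₁ j ≡ procs (g i) ×
    load g (suc i) + p₂ j ≤ due j × lastDue g i + p₂ j ≤ due j

  gain : (ℕ → Bool) → ℕ → ℕ
  gain s k = sumTo k λ j → if s j then wt j else 0

  record Compatible (g : ℕ → ℕ) (s : ℕ → Bool) : Set where
    field
      eligible : ∀ j → j < n → s j ≡ true → Eligible g j
      unique   : ∀ j j′ → j < n → j′ < n → s j ≡ true → s j′ ≡ true → due j ≡ due j′ → j ≡ j′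

  Maximal : (ℕ → ℕ) → (ℕ → Bool) → Set
  Maximal g s = ∀ j → j < n → Eligible g j →
    ∃ λ j′ → j′ < n × due j ≡ due j′ × s j′ ≡ true × wt j ≤ wt j′

  load-cong : ∀ {g h} i → (∀ l → l < i → g l ≡ h l) → load g i ≡ load h i
  load-cong zero    e = refl
  load-cong (suc i) e = cong₂ _+_ (load-cong i λ l l<i → e l (m<n⇒m<1+n l<i)) (cong procs (e i ≤-refl))

  lastDue-cong : ∀ {g h} i → (∀ l → l < i → g l ≡ h l) → lastDue g i ≡ lastDue h i
  lastDue-cong zero    e = refl
  lastDue-cong (suc i) e rewrite e i ≤-refl | lastDue-cong i (λ l l<i → e l (m<n⇒m<1+n l<i)) = refl

  eligible-cong : ∀ {g h} → (∀ l → l < D → g l ≡ h l) → ∀ {j} → Eligible g j → Eligible h j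
  eligible-cong e {j} (i , i<D , dj , pj , l , r) = i , i<D , dj , trans pj (cong procs (e i i<D)) ,
    subst (λ x → x + p₂ j ≤ due j) (load-cong (suc i) λ l l≤i → e l (≤-trans l≤i i<D)) l ,
    subst (λ x → x + p₂ j ≤ due j) (lastDue-cong i λ l l<i → e l (<-trans l<i i<D)) r

  gain-cong : ∀ {s s′} k → (∀ j → j < k → s j ≡ s′ j) → gain s k ≡ gain s′ k
  gain-cong k e = sumTo-cong k λ j j<k → cong (if_then wt j else 0) (e j j<k)

  compatible-cong : ∀ {g s s′} → (∀ j → j < n → s j ≡ s′ j) → Compatible g s → Compatible g s′
  compatible-cong e C = record
    { eligible = λ j j<n t → eligible j j<n (trans (e j j<n) t)
    ; unique   = λ j j′ j<n j′<n t t′ → unique j j′ j<n j′<n (trans (e j j<n) t) (trans (e j′ j′<n) t′)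
    } where open Compatible C

  -- The due dates act as classes in `sumTo-dominated`: uniqueness in `s′` makes them different, and
  -- maximality of `s` supplies the dominating jobs. The guesses are compared only below `D`, since
  -- only these digits are meaningful.
  maximal-gain : ∀ {g h s s′} → (∀ l → l < D → h l ≡ g l) → Maximal g s → Compatible h s′ →
                 gain s′ n ≤ gain s n
  maximal-gain {g} {h} {s} {s′} h≡g max C = sumTo-dominated n n _ _ due dom
    λ j j′ j<n j′<n uj uj′ → unique j j′ j<n j′<n (chosen j uj) (chosen j′ uj′)
    where
    open Compatible C
    chosen : ∀ j → (if s′ j then wt j else 0) ≢ 0 → s′ j ≡ true
    chosen j h with s′ j
    ... | true  = refl
    ... | false = contradiction refl h
    dom : ∀ j → j < n → (if s′ j then wt j else 0) ≢ 0 →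
          ∃ λ j′ → j′ < n × due j ≡ due j′ × (if s′ j then wt j else 0) ≤ (if s j′ then wt j′ else 0)
    dom j j<n uj with max j j<n (eligible-cong h≡g (eligible j j<n (chosen j uj)))
    ... | j′ , j′<n , dj , sj′ , w≤ = j′ , j′<n , dj ,
      ≤-trans (if≤ (s′ j)) (subst (λ b → wt j ≤ (if b then wt j′ else 0)) (sym sj′) w≤)
      where
      if≤ : ∀ b → (if b then wt j else 0) ≤ wt j
      if≤ true  = ≤-refl
      if≤ false = z≤n

  -- The term `a + (b ∸ a)` is the maximum of `a` and `b`, written with the machine's operations. It
  -- merges the two time conditions of `Eligible` into one earliest start on M₂.
  record Prepared (g : ℕ → ℕ) (k : ℕ) (sel ready top pick : ℕ → ℕ) : Set where
    field
      sel≡   : ∀ i → i < k → sel (dues (suc i)) ≡ procs (g i)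
      ready≡ : ∀ i → i < k → ready (dues (suc i)) ≡ load g (suc i) + (lastDue g i ∸ load g (suc i))
      top≡   : ∀ i → i < k → top (dues (suc i)) ≡ 0
      pick≡  : ∀ i → i < k → pick (dues (suc i)) ≡ 0

  prepared-suc : ∀ {g k sel ready top pick e x r} → Enumeration due n D dues → k < D →
    e ≡ dues (suc k) → x ≡ procs (g k) → r ≡ load g (suc k) + (lastDue g k ∸ load g (suc k)) →
    Prepared g k sel ready top pick →
    Prepared g (suc k) (update sel e x) (update ready e r) (update top e 0) (update pick e 0)
  prepared-suc {k = k} {sel} {ready} {top} {pick} {e} E k<D refl refl refl pr = record
    { sel≡   = write sel sel≡
    ; ready≡ = write ready ready≡
    ; top≡   = write top top≡
    ; pick≡  = write pick pick≡
    }
    where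
    open Prepared pr
    write : ∀ f {h : ℕ → ℕ} → (∀ i → i < k → f (dues (suc i)) ≡ h i) →
            ∀ i → i < suc k → update f e (h k) (dues (suc i)) ≡ h i
    write f old = ∀<-suc
      (λ i i<k → trans (update-≢ f (<⇒≢ (enumeration-< E (s≤s i<k) k<D))) (old i i<k))
      (update-≡ f {e} refl)

  module _ (sel ready : ℕ → ℕ) where

    Fits : ℕ → Set
    Fits j = sel (due j) ≡ p₁ j × ready (due j) + p₂ j ≤ due j

    Witness : (d t p : ℕ) → Set
    Witness d t p = (t ≡ 0 × p ≡ 0) ⊎
      ∃ λ j′ → j′ < n × d ≡ due j′ × Fits j′ × p ≡ suc j′ × t ≡ wt j′

    -- `witness` ranges over all jobs from the outset: a due date first met in a later round must be
    -- known to have an empty entry until then.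
    record Choice (k : ℕ) (top pick : ℕ → ℕ) : Set where
      field
        highest : ∀ j → j < k → Fits j → wt j ≤ top (due j)
        witness : ∀ j → j < n → Witness (due j) (top (due j)) (pick (due j))

    choice-skip : ∀ {k top pick} → Choice k top pick → (Fits k → wt k ≤ top (due k)) → Choice (suc k) top pick
    choice-skip C h = record { highest = ∀<-suc (Choice.highest C) h ; witness = Choice.witness C }

    choice-new : ∀ {k top pick} → k < n → Choice k top pick → Fits k → top (due k) < wt k →
      Choice (suc k) (update top (due k) (wt k)) (update pick (due k) (suc k))
    choice-new {k} {top} {pick} k<n C fits top< = record { highest = ∀<-suc high new ; witness = wit }
      where
      open Choice C
      new : Fits k → wt k ≤ update top (due k) (wt k) (due k)
      new _ = ≤-reflexive (sym (update-≡ top {due k} refl))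
      high : ∀ j → j < k → Fits j → wt j ≤ update top (due k) (wt k) (due j)
      high j j<k f with due j ≟ due k
      ... | yes e = ≤-trans (highest j j<k f) (≤-trans (≤-reflexive (cong top e))
                      (≤-trans (<⇒≤ top<) (≤-reflexive (sym (update-≡ top e)))))
      ... | no ne = ≤-trans (highest j j<k f) (≤-reflexive (sym (update-≢ top ne)))
      wit : ∀ j → j < n → Witness (due j) (update top (due k) (wt k) (due j)) (update pick (due k) (suc k) (due j))
      wit j j<n with due j ≟ due k
      ... | yes e = inj₂ (k , k<n , e , fits , update-≡ pick e , update-≡ top e)
      ... | no ne = subst₂ (Witness (due j)) (sym (update-≢ top ne)) (sym (update-≢ pick ne)) (witness j j<n)

    picked : (ℕ → ℕ) → ℕ → Bool
    picked pick j = pick (due j) ≡ᵇ suc j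

    module _ {g top₀ pick₀}
             (E : Enumeration due n D dues) (cover : ∀ j → j < n → ∃ λ i → i < D × due j ≡ dues (suc i))
             (wt>0 : ∀ j → j < n → 0 < wt j)
             (pr : Prepared g D sel ready top₀ pick₀) where

      open Prepared pr

      choice-init : Choice 0 top₀ pick₀
      choice-init = record { highest = λ _ () ; witness = wit }
        where
        wit : ∀ j → j < n → Witness (due j) (top₀ (due j)) (pick₀ (due j))
        wit j j<n with cover j j<n
        ... | i , i<D , e rewrite e = inj₁ (top≡ i i<D , pick≡ i i<D)

      fits⇒eligible : ∀ j → j < n → Fits j → Eligible g j
      fits⇒eligible j j<n (s , r) with cover j j<n
      ... | i , i<D , e = i , i<D , e ,
        trans (sym s) (trans (cong sel e) (sel≡ i i<D)) ,
        ≤-trans (+-monoˡ-≤ (p₂ j) (m≤m+n _ _)) r′ ,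
        ≤-trans (+-monoˡ-≤ (p₂ j) (m≤n+m∸n (lastDue g i) (load g (suc i)))) r′
        where
        r′ : load g (suc i) + (lastDue g i ∸ load g (suc i)) + p₂ j ≤ due j
        r′ = subst (λ x → x + p₂ j ≤ due j) (trans (cong ready e) (ready≡ i i<D)) r

      eligible⇒fits : ∀ j → Eligible g j → Fits j
      eligible⇒fits j (i , i<D , e , pj , l , r) =
        trans (cong sel e) (trans (sel≡ i i<D) (sym pj)) ,
        subst (λ x → x + p₂ j ≤ due j) (sym (trans (cong ready e) (ready≡ i i<D))) max
        where
        a = load g (suc i)
        b = lastDue g i
        max : a + (b ∸ a) + p₂ j ≤ due j
        max with ≤-total a b
        ... | inj₁ a≤b rewrite m+[n∸m]≡n a≤b = r
        ... | inj₂ b≤a rewrite m≤n⇒m∸n≡0 b≤a | +-identityʳ a = l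

      choice-compatible : ∀ {top pick} → Choice n top pick → Compatible g (picked pick)
      choice-compatible {pick = pick} C = record { eligible = elig ; unique = uniq }
        where
        open Choice C
        elig : ∀ j → j < n → picked pick j ≡ true → Eligible g j
        elig j j<n t with witness j j<n
        ... | inj₁ (_ , p) = contradiction (trans (sym p) (≡ᵇ-true t)) λ()
        ... | inj₂ (j′ , _ , _ , f , p , _) with trans (sym p) (≡ᵇ-true t)
        ...   | refl = fits⇒eligible j j<n f
        uniq : ∀ j j′ → j < n → j′ < n → picked pick j ≡ true → picked pick j′ ≡ true → due j ≡ due j′ → j ≡ j′
        uniq j j′ _ _ t t′ e = suc-injective
          (trans (sym (≡ᵇ-true t)) (trans (cong pick e) (≡ᵇ-true {pick (due j′)} t′)))

      choice-maximal : ∀ {top pick} → Choice n top pick → Maximal g (picked pick)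
      choice-maximal {pick = pick} C j j<n el with Choice.highest C j j<n (eligible⇒fits j el) | Choice.witness C j j<n
      -- An empty entry has height 0, which cannot bound the positive weight of the eligible job
      -- `j`.
      ... | w≤ | inj₁ (t , _) = contradiction (<-≤-trans (wt>0 j j<n) (subst (wt j ≤_) t w≤)) λ()
      ... | w≤ | inj₂ (j′ , j′<n , e , _ , p , t) =
        j′ , j′<n , e , trans (cong (_≡ᵇ suc j′) (trans (cong pick (sym e)) p)) (≡ᵇ-refl (suc j′)) ,
        subst (wt j ≤_) t w≤

-- Guesses as numbers in base `suc q`, least significant digit first

value : ℕ → (ℕ → ℕ) → ℕ → ℕ
value B g k = sumTo k λ i → g i * B ^ i

value-< : ∀ {B g} k → (∀ i → i < k → g i < B) → value B g k < B ^ k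
value-< zero _ = ≤-refl
value-< {B} {g} (suc k) lt = begin-strict
  value B g k + g k * B ^ k  <⟨ +-monoˡ-< _ (value-< k λ i i<k → lt i (m<n⇒m<1+n i<k)) ⟩
  suc (g k) * B ^ k          ≤⟨ *-monoˡ-≤ (B ^ k) (lt k ≤-refl) ⟩
  B ^ suc k                  ∎
  where open ≤-Reasoning

quotient-≤ : ∀ {b r r′ a a′} → r < b → r + a * b ≡ r′ + a′ * b → a′ ≤ a
quotient-≤ {b} {r} {r′} {a} {a′} r<b eq = ≮⇒≥ λ a<a′ → <-irrefl eq (begin-strict
  r + a * b   <⟨ +-monoˡ-< _ r<b ⟩
  suc a * b   ≤⟨ *-monoˡ-≤ b a<a′ ⟩
  a′ * b      ≤⟨ m≤n+m _ r′ ⟩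
  r′ + a′ * b ∎)
  where open ≤-Reasoning

-- Lets a guess be recognised by its number. The leading digits agree because both remainders are
-- below `B ^ k`.
value-injective : ∀ {B g h} k → (∀ i → i < k → g i < B) → (∀ i → i < k → h i < B) →
                  value B g k ≡ value B h k → ∀ i → i < k → g i ≡ h i
value-injective {B} {g} {h} (suc k) g<B h<B eq = ∀<-suc
  (value-injective k g< h< (+-cancelʳ-≡ (h k * B ^ k) _ _
    (trans (cong (λ x → value B g k + x * B ^ k) (sym top≡)) eq)))
  top≡
  where
  g< = λ i i<k → g<B i (m<n⇒m<1+n i<k)
  h< = λ i i<k → h<B i (m<n⇒m<1+n i<k)
  top≡ : g k ≡ h k
  top≡ = ≤-antisym (quotient-≤ (value-< k h<) (sym eq)) (quotient-≤ (value-< k g<) eq)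

-- The old and the new digit stand on opposite sides, which avoids truncated subtraction.
value-update : ∀ {B k i} g v → i < k →
               value B (update g i v) k + g i * B ^ i ≡ value B g k + v * B ^ i
value-update {B} {k} {i} g v i<k = begin
  value B g′ k + y    ≡⟨ cong (_+ y) (sumTo-remove k f′ i<k) ⟩
  S′ + f′ i + y       ≡⟨ +-assoc S′ _ y ⟩
  S′ + (f′ i + y)     ≡⟨ cong₂ _+_ (sumTo-cong k same) (+-comm (f′ i) y) ⟩
  S + (y + f′ i)      ≡⟨ +-assoc S y _ ⟨
  S + y + f′ i        ≡⟨ cong₂ _+_ (sym (sumTo-remove k f i<k)) (cong (_* B ^ i) (update-≡ g {i} refl)) ⟩
  value B g k + v * B ^ i ∎
  where
  open ≡-Reasoning
  g′ = update g i v
  f  = λ l → g l * B ^ l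
  f′ = λ l → g′ l * B ^ l
  S  = sumTo k (update f i 0)
  S′ = sumTo k (update f′ i 0)
  y  = g i * B ^ i
  same : ∀ l → l < k → update f′ i 0 l ≡ update f i 0 l
  same l _ with l ≡ᵇ i
  ... | true  = refl
  ... | false = refl

-- Digit D is a sentinel: it is 0 ≠ q when an increment starts, so the carry
-- stops there at the latest, and the enumeration ends once it is nonzero.
increment : Cmd
increment = #i ≔ lit 0 ⨾
  while ($digit [ var #i ] ≈ var #q) ($digit [ var #i ]≔ lit 0 ⨾ #i ≔ var #i ⊕ lit 1) ⨾
  $digit [ var #i ]≔ $digit [ var #i ] ⊕ lit 1

-- A carry may pass all `D` digits. There are at most as many due dates as jobs, so even this worst
-- case stays within the linear budget of one guess.
runIncrement : ∀ {M} .{{_ : NonZero M}} {D q} σ → reg σ #q ≡ q → 0 < q → suc D ≤ M →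
  let g = arr σ $digit ; B = suc q in
  (∀ i → i < suc D → g i < B) → g D ≡ 0 →
  Run M increment σ λ σ′ → let g′ = arr σ′ $digit in
    (∀ i → i < suc D → g′ i < B) × value B g′ (suc D) ≡ suc (value B g (suc D))
runIncrement {M} {D} {q} σ refl q>0 D<M g<B gD = runSeq (runReg
  (runWhile Inv D (subst (_≤ M) (sym (*-identityʳ (suc D))) D<M)
    (+-identityʳ D , g<B , gD , +-comm _ 1) step
   ∙> λ { {σ′} fr (_ , stop , k , inv) → runArr (finish σ′ (onReg fr #q refl) (≡ᵇ-false stop) k inv) }))
  where
  B = suc q
  V = value B (arr σ $digit) (suc D)
  Inv : ℕ → State → Set
  -- Digit i still has to receive a carry, worth B ^ i.
  Inv k σ′ = let g′ = arr σ′ $digit in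
    k + reg σ′ #i ≡ D × (∀ i → i < suc D → g′ i < B) × g′ D ≡ 0 ×
    value B g′ (suc D) + B ^ reg σ′ #i ≡ suc V

  step : ∀ k σ′ → Frame _ (setReg σ #i 0) σ′ → test σ′ ($digit [ var #i ] ≈ var #q) ≡ true → Inv k σ′ →
         ∃ λ k′ → k ≡ suc k′ × Run 1 ($digit [ var #i ]≔ lit 0 ⨾ #i ≔ var #i ⊕ lit 1) σ′ (Inv k′)
  step zero σ′ fr go (refl , _ , 0≡ , _) =
    contradiction (trans (sym 0≡) (trans (≡ᵇ-true go) (onReg fr #q refl))) (<⇒≢ q>0)
  step (suc k) σ′ fr go (eq , lt , 0≡ , v) = k , refl , runSeq (runArr (runReg (inv (+-comm i 1))))
    where
    i = reg σ′ #i
    g = arr σ′ $digit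
    g′ = update g i 0
    i<D : i < D
    i<D = subst (i <_) eq (m<1+n+m i)
      where m<1+n+m : ∀ m → m < suc k + m
            m<1+n+m m = s≤s (m≤n+m m k)
    gi≡q : g i ≡ q
    gi≡q = trans (≡ᵇ-true go) (onReg fr #q refl)
    lt′ : ∀ l → l < suc D → g′ l < B
    lt′ l l≤D with l ≡ᵇ i
    ... | true  = s≤s z≤n
    ... | false = lt l l≤D
    inv : ∀ {i′} → i′ ≡ suc i → k + i′ ≡ D × (∀ l → l < suc D → g′ l < B) × g′ D ≡ 0 ×
          value B g′ (suc D) + B ^ i′ ≡ suc V
    inv refl = trans (+-suc k i) eq , lt′ , trans (update-≢ g (>⇒≢ i<D)) 0≡ , (begin
      value B g′ (suc D) + (B ^ i + q * B ^ i)    ≡⟨ cong (value B g′ (suc D) +_) (+-comm (B ^ i) _) ⟩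
      value B g′ (suc D) + (q * B ^ i + B ^ i)    ≡⟨ +-assoc (value B g′ (suc D)) _ _ ⟨
      value B g′ (suc D) + q * B ^ i + B ^ i      ≡⟨ cong (λ x → value B g′ (suc D) + x * B ^ i + B ^ i) gi≡q ⟨
      value B g′ (suc D) + g i * B ^ i + B ^ i    ≡⟨ cong (_+ B ^ i) (value-update g 0 (m<n⇒m<1+n i<D)) ⟩
      value B g (suc D) + 0 + B ^ i               ≡⟨ cong (_+ B ^ i) (+-identityʳ (value B g (suc D))) ⟩
      value B g (suc D) + B ^ i                   ≡⟨ v ⟩
      suc V                                       ∎)
      where open ≡-Reasoning

  finish : ∀ σ′ → reg σ′ #q ≡ q → arr σ′ $digit (reg σ′ #i) ≢ reg σ′ #q → ∀ k → Inv k σ′ →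
    let i = reg σ′ #i ; g = arr σ′ $digit ; g′ = update g i (g i + 1) in
    (∀ l → l < suc D → g′ l < B) × value B g′ (suc D) ≡ suc V
  finish σ′ q≡ gi≢q k (eq , lt , _ , v) = lt′ , +-cancelʳ-≡ (g i * B ^ i) _ _ (begin
      value B g′ (suc D) + g i * B ^ i              ≡⟨ value-update g (g i + 1) i≤D ⟩
      value B g (suc D) + (g i + 1) * B ^ i         ≡⟨ cong (λ x → value B g (suc D) + x * B ^ i) (+-comm (g i) 1) ⟩
      value B g (suc D) + (B ^ i + g i * B ^ i)     ≡⟨ +-assoc (value B g (suc D)) _ _ ⟨
      value B g (suc D) + B ^ i + g i * B ^ i       ≡⟨ cong (_+ g i * B ^ i) v ⟩
      suc V + g i * B ^ i                           ∎)
    where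
    open ≡-Reasoning
    i = reg σ′ #i
    g = arr σ′ $digit
    g′ = update g i (g i + 1)
    i≤D : i < suc D
    i≤D = s≤s (subst (i ≤_) eq (m≤n+m i k))
    gi<q : g i < q
    gi<q = ≤∧≢⇒< (s≤s⁻¹ (lt i i≤D)) λ e → gi≢q (trans e (sym q≡))
    lt′ : ∀ l → l < suc D → g′ l < B
    lt′ l l≤D with l ≡ᵇ i
    ... | true  = s≤s (subst (_≤ q) (+-comm 1 (g i)) gi<q)
    ... | false = lt l l≤D

-- The search program

-- The tables $sel, $ready, $top and $pick are addressed by due dates, not
-- by their ranks.  $pick holds the number of the chosen job plus one.
prepareDue prepare : Cmd
prepareDue =
  #t ≔ var #t ⊕ x ⨾
  $sel [ d ]≔ x ⨾
  -- At this point `#t` already includes the time reserved for the present due date, whereas `#prev`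
  -- still refers to the earlier ones: hence `load g (suc i)` beside `lastDue g i`.
  $ready [ d ]≔ var #t ⊕ (var #prev ⊖ var #t) ⨾
  $top [ d ]≔ lit 0 ⨾
  $pick [ d ]≔ lit 0 ⨾
  ifᶜ (lit 0 ≺ x) (#prev ≔ d) skip
  where
  d = $dues [ var #i ⊕ lit 1 ]
  x = $procs [ $digit [ var #i ] ]
prepare = #t ≔ lit 0 ⨾ #prev ≔ lit 0 ⨾ for #i #D prepareDue

tryJob choose : Cmd
tryJob =
  ifᶜ ($sel [ d ] ≈ $p₁ [ var #j ])
    (ifᶜ (d ≺ $ready [ d ] ⊕ $p₂ [ var #j ])
      skip
      (ifᶜ ($top [ d ] ≺ $wt [ var #j ])
        ($top [ d ]≔ $wt [ var #j ] ⨾ $pick [ d ]≔ var #j ⊕ lit 1)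
        skip))
    skip
  where d = $due [ var #j ]
choose = for #j #n tryJob

isPicked : Test
isPicked = $pick [ $due [ var #j ] ] ≈ var #j ⊕ lit 1

total copy evaluate search : Cmd
total = #tot ≔ lit 0 ⨾ for #j #n (ifᶜ isPicked (#tot ≔ var #tot ⊕ $wt [ var #j ]) skip)
copy = for #j #n (ifᶜ isPicked ($out [ var #j ]≔ lit 1) ($out [ var #j ]≔ lit 0))
evaluate = prepare ⨾ choose ⨾ total ⨾
  ifᶜ (var #best ≺ var #tot) (#best ≔ var #tot ⨾ copy) skip
search = while ($digit [ var #D ] ≈ lit 0) (evaluate ⨾ increment)

-- Correctness and cost of the search

module Searching (n D q : ℕ) (due wt p₁ p₂ dues procs : ℕ → ℕ)
  (E : Enumeration due n D dues) (cover : ∀ j → j < n → ∃ λ i → i < D × due j ≡ dues (suc i))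
  (wt>0 : ∀ j → j < n → 0 < wt j) (D≤n : D ≤ n) (q>0 : 0 < q) where

  open Guessing n D due wt p₁ p₂ dues procs

  record Env (σ : State) : Set where
    field
      n≡     : reg σ #n ≡ n
      D≡     : reg σ #D ≡ D
      q≡     : reg σ #q ≡ q
      due≡   : arr σ $due ≡ due
      wt≡    : arr σ $wt ≡ wt
      p₁≡    : arr σ $p₁ ≡ p₁
      p₂≡    : arr σ $p₂ ≡ p₂
      dues≡  : arr σ $dues ≡ dues
      procs≡ : arr σ $procs ≡ procs
  open Env

  ReadOnly : Cmd → Set
  ReadOnly c =
    writesᵣ c #n ≡ false × writesᵣ c #D ≡ false × writesᵣ c #q ≡ false ×
    writesₐ c $due ≡ false × writesₐ c $wt ≡ false × writesₐ c $p₁ ≡ false × writesₐ c $p₂ ≡ false ×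
    writesₐ c $dues ≡ false × writesₐ c $procs ≡ false

  pattern readOnly = refl , refl , refl , refl , refl , refl , refl , refl , refl

  frame-env : ∀ {c σ σ′} → ReadOnly c → Frame c σ σ′ → Env σ → Env σ′
  frame-env (r₁ , r₂ , r₃ , a₁ , a₂ , a₃ , a₄ , a₅ , a₆) fr env = record
    { n≡     = trans (onReg fr #n r₁) (n≡ env)
    ; D≡     = trans (onReg fr #D r₂) (D≡ env)
    ; q≡     = trans (onReg fr #q r₃) (q≡ env)
    ; due≡   = trans (onArr fr $due a₁) (due≡ env)
    ; wt≡    = trans (onArr fr $wt a₂) (wt≡ env)
    ; p₁≡    = trans (onArr fr $p₁ a₃) (p₁≡ env)
    ; p₂≡    = trans (onArr fr $p₂ a₄) (p₂≡ env)
    ; dues≡  = trans (onArr fr $dues a₅) (dues≡ env)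
    ; procs≡ = trans (onArr fr $procs a₆) (procs≡ env)
    }

  at : {f g : ℕ → ℕ} {x y : ℕ} → f ≡ g → x ≡ y → f x ≡ g y
  at refl refl = refl

  runPrepare : ∀ {σ} → Env σ → Run (suc n) prepare σ λ σ′ →
    Prepared (arr σ $digit) D (arr σ′ $sel) (arr σ′ $ready) (arr σ′ $top) (arr σ′ $pick)
  runPrepare {σ} env = runSeq (runReg (runSeq (runReg
    (conseq (λ _ → λ { (_ , _ , pr) → pr })
      (runFor J refl refl refl (D≡ env) (subst (_≤ suc n) (sym (*-identityʳ (suc D))) (s≤s D≤n))
        (refl , refl , record { sel≡ = λ _ () ; ready≡ = λ _ () ; top≡ = λ _ () ; pick≡ = λ _ () })
        step)))))
    where
    g = arr σ $digit
    σ₁ = setReg (setReg σ #t 0) #prev 0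
    J : ℕ → State → Set
    J k σ′ = reg σ′ #t ≡ load g k × reg σ′ #prev ≡ lastDue g k ×
      Prepared g k (arr σ′ $sel) (arr σ′ $ready) (arr σ′ $top) (arr σ′ $pick)
    step : ∀ k σ′ → k < D → Frame (for #i #D prepareDue) σ₁ σ′ → reg σ′ #i ≡ k → J k σ′ →
           Run 1 prepareDue σ′ λ σ″ → J (suc k) (setReg σ″ #i (suc k))
    step k σ′ k<D fr i≡ (t≡ , prev≡ , pr) =
      runSeq $ runReg $ runSeq $ runArr $ runSeq $ runArr $ runSeq $ runArr $ runSeq $ runArr $
      runIf (λ go → runReg (t′≡ , prev-yes go , pr′))
            (λ stop → runSkip (t′≡ , prev-no stop , pr′))
      where
      env′ : Env σ′
      -- Rebuilding the record moves it from `σ` to `σ₁`: the two states agree definitionally on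
      -- every component that `Env` mentions.
      env′ = frame-env readOnly fr record { Env env }
      x = arr σ′ $procs (arr σ′ $digit (reg σ′ #i))
      d = arr σ′ $dues (reg σ′ #i + 1)
      x≡ : x ≡ procs (g k)
      x≡ = at (procs≡ env′) (at (onArr fr $digit refl) i≡)
      d≡ : d ≡ dues (suc k)
      d≡ = at (dues≡ env′) (trans (+-comm _ 1) (cong suc i≡))
      t′≡ : reg σ′ #t + x ≡ load g (suc k)
      t′≡ = cong₂ _+_ t≡ x≡
      pr′ = prepared-suc E k<D d≡ x≡ (cong₂ (λ a b → a + (b ∸ a)) t′≡ prev≡) pr
      prev-yes : (0 <ᵇ x) ≡ true → d ≡ lastDue g (suc k)
      prev-yes go rewrite sym x≡ | go = d≡
      prev-no : (0 <ᵇ x) ≡ false → reg σ′ #prev ≡ lastDue g (suc k)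
      prev-no stop rewrite sym x≡ | stop = prev≡

  module _ (sel ready : ℕ → ℕ) where

    private
      Choice′ : ℕ → State → Set
      Choice′ k σ = Choice sel ready k (arr σ $top) (arr σ $pick)

    runChoose : ∀ {σ} → Env σ → arr σ $sel ≡ sel → arr σ $ready ≡ ready → Choice′ 0 σ →
                Run (suc n) choose σ (Choice′ n)
    runChoose {σ} env sel≡ ready≡ c₀ =
      runFor Choice′ refl refl refl (n≡ env) (≤-reflexive (*-identityʳ (suc n))) c₀ step
      where
      step : ∀ k σ′ → k < n → Frame choose σ σ′ → reg σ′ #j ≡ k → Choice′ k σ′ →
             Run 1 tryJob σ′ λ σ″ → Choice′ (suc k) (setReg σ″ #j (suc k))
      step k σ′ k<n fr j≡ ch = runIf
        (λ eq → let s≡ = subst₂ _≡_ sd≡ p₁k≡ (≡ᵇ-true eq) in runIf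
          (λ late → runSkip (choice-skip sel ready ch λ (_ , r) →
            contradiction (subst₂ _<_ d≡ (cong₂ _+_ rd≡ p₂k≡) (<ᵇ-true late)) (≤⇒≯ r)))
          (λ early → let fits = s≡ , subst₂ _≤_ (cong₂ _+_ rd≡ p₂k≡) d≡ (<ᵇ-false early) in runIf
            (λ better → runSeq (runArr (runArr (new fits
              (subst₂ _<_ (cong (arr σ′ $top) d≡) w≡ (<ᵇ-true better))))))
            (λ worse → runSkip (choice-skip sel ready ch λ _ →
              subst₂ _≤_ w≡ (cong (arr σ′ $top) d≡) (<ᵇ-false worse)))))
        (λ ne → runSkip (choice-skip sel ready ch λ (s , _) →
          contradiction (subst₂ _≡_ (sym sd≡) (sym p₁k≡) s) (≡ᵇ-false ne)))
        where
        env′ : Env σ′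
        env′ = frame-env readOnly fr env
        d  = arr σ′ $due (reg σ′ #j)
        d≡ : d ≡ due k
        d≡ = at (due≡ env′) j≡
        w≡ : arr σ′ $wt (reg σ′ #j) ≡ wt k
        w≡ = at (wt≡ env′) j≡
        sd≡ : arr σ′ $sel d ≡ sel (due k)
        sd≡ = at (trans (onArr fr $sel refl) sel≡) d≡
        rd≡ : arr σ′ $ready d ≡ ready (due k)
        rd≡ = at (trans (onArr fr $ready refl) ready≡) d≡
        p₁k≡ : arr σ′ $p₁ (reg σ′ #j) ≡ p₁ k
        p₁k≡ = at (p₁≡ env′) j≡
        p₂k≡ : arr σ′ $p₂ (reg σ′ #j) ≡ p₂ k
        p₂k≡ = at (p₂≡ env′) j≡
        new : Fits sel ready k → arr σ′ $top (due k) < wt k →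
              Choice sel ready (suc k) (update (arr σ′ $top) d (arr σ′ $wt (reg σ′ #j)))
                                       (update (arr σ′ $pick) d (reg σ′ #j + 1))
        new fits top< rewrite d≡ | w≡ | j≡ | +-comm k 1 = choice-new sel ready k<n ch fits top<

  picks : State → ℕ → Bool
  picks σ j = arr σ $pick (due j) ≡ᵇ suc j

  isPicked≡ : ∀ {σ} k → Env σ → reg σ #j ≡ k → test σ isPicked ≡ picks σ k
  isPicked≡ {σ} k env j≡ = cong₂ _≡ᵇ_ (cong (arr σ $pick) (at (due≡ env) j≡)) (trans (+-comm _ 1) (cong suc j≡))

  runTotal : ∀ {σ} → Env σ → Run (suc n) total σ λ σ′ → reg σ′ #tot ≡ gain (picks σ) n
  runTotal {σ} env = runSeq (runReg
    (runFor J refl refl refl (n≡ env) (≤-reflexive (*-identityʳ (suc n))) refl step))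
    where
    J : ℕ → State → Set
    J k σ′ = reg σ′ #tot ≡ gain (picks σ) k
    step : ∀ k σ′ → k < n → Frame _ (setReg σ #tot 0) σ′ → reg σ′ #j ≡ k → J k σ′ →
           Run 1 (ifᶜ isPicked (#tot ≔ var #tot ⊕ $wt [ var #j ]) skip) σ′
             λ σ″ → J (suc k) (setReg σ″ #j (suc k))
    step k σ′ k<n fr j≡ t≡ = runIf
      (λ hit → runReg (cong₂ _+_ t≡ (trans (at (wt≡ env′) j≡) (added hit))))
      (λ miss → runSkip (trans t≡ (trans (sym (+-identityʳ _)) (cong (gain (picks σ) k +_) (added miss)))))
      where
      env′ : Env σ′
      env′ = frame-env readOnly fr record { Env env }
      p≡ : test σ′ isPicked ≡ picks σ k
      p≡ = trans (isPicked≡ k env′ j≡) (cong (λ f → f (due k) ≡ᵇ suc k) (onArr fr $pick refl))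
      added : ∀ {b} → test σ′ isPicked ≡ b → (if b then wt k else 0) ≡ (if picks σ k then wt k else 0)
      added e = cong (if_then wt k else 0) (trans (sym e) p≡)

  outputs : State → ℕ → Bool
  outputs σ j = 0 <ᵇ arr σ $out j

  runCopy : ∀ {σ} → Env σ → Run (suc n) copy σ λ σ′ → ∀ j → j < n → picks σ j ≡ outputs σ′ j
  runCopy {σ} env =
    runFor J refl refl refl (n≡ env) (≤-reflexive (*-identityʳ (suc n))) (λ _ ()) step
    where
    J : ℕ → State → Set
    J k σ′ = ∀ j → j < k → picks σ j ≡ outputs σ′ j
    step : ∀ k σ′ → k < n → Frame copy σ σ′ → reg σ′ #j ≡ k → J k σ′ →
           Run 1 (ifᶜ isPicked ($out [ var #j ]≔ lit 1) ($out [ var #j ]≔ lit 0)) σ′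
             λ σ″ → J (suc k) (setReg σ″ #j (suc k))
    step k σ′ k<n fr j≡ old = runIf
      (λ hit → runArr (write 1 (trans (sym p≡) hit)))
      (λ miss → runArr (write 0 (trans (sym p≡) miss)))
      where
      p≡ : test σ′ isPicked ≡ picks σ k
      p≡ = trans (isPicked≡ k (frame-env readOnly fr env) j≡)
             (cong (λ f → f (due k) ≡ᵇ suc k) (onArr fr $pick refl))
      write : ∀ v → picks σ k ≡ (0 <ᵇ v) → ∀ j → j < suc k →
              picks σ j ≡ (0 <ᵇ update (arr σ′ $out) (reg σ′ #j) v j)
      write v e rewrite j≡ = ∀<-suc
        (λ j j<k → trans (old j j<k) (cong (0 <ᵇ_) (sym (update-≢ (arr σ′ $out) (<⇒≢ j<k)))))
        (trans e (cong (0 <ᵇ_) (sym (update-≡ (arr σ′ $out) {k} refl))))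

  Improves : State → State → (ℕ → Bool) → Set
  Improves σ σ′ s =
    (reg σ′ #best ≡ reg σ #best × outputs σ′ ≡ outputs σ × gain s n ≤ reg σ #best) ⊎
    (reg σ #best < gain s n × reg σ′ #best ≡ gain s n × (∀ j → j < n → s j ≡ outputs σ′ j))

  runEvaluate : ∀ {σ} → Env σ → Run (suc n) evaluate σ λ σ′ →
    ∃ λ s → Compatible (arr σ $digit) s × Maximal (arr σ $digit) s × Improves σ σ′ s
  runEvaluate {σ} env =
    runPrepare env ∙> λ {σ₁} fr₁ pr →
    let env₁ = frame-env readOnly fr₁ env
        sel = arr σ₁ $sel ; ready = arr σ₁ $ready in
    runChoose sel ready env₁ refl refl (choice-init sel ready E cover wt>0 pr) ∙> λ {σ₂} fr₂ ch →
    let env₂ = frame-env readOnly fr₂ env₁ in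
    runTotal env₂ ∙> λ {σ₃} fr₃ tot≡ →
    let env₃ = frame-env readOnly fr₃ env₂
        s = picks σ₂
        best≡ = trans (onReg fr₃ #best refl) (trans (onReg fr₂ #best refl) (onReg fr₁ #best refl))
        out≡ = trans (onArr fr₃ $out refl) (trans (onArr fr₂ $out refl) (onArr fr₁ $out refl))
        done : ∀ σ′ → Improves σ σ′ s →
               ∃ λ s → Compatible (arr σ $digit) s × Maximal (arr σ $digit) s × Improves σ σ′ s
        done _ imp = s , choice-compatible sel ready E cover wt>0 pr ch ,
                   choice-maximal sel ready E cover wt>0 pr ch , imp
    in runIf
      (λ better → runSeq (runReg (conseq
        (λ {σ₄} fr₄ copied → done σ₄ (inj₂ (subst₂ _<_ best≡ tot≡ (<ᵇ-true better) ,
          trans (onReg fr₄ #best refl) tot≡ ,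
          λ j j<n → trans (cong (λ f → f (due j) ≡ᵇ suc j) (sym (onArr fr₃ $pick refl))) (copied j j<n))))
        (runCopy record { Env env₃ }))))
      (λ worse → runSkip (done σ₃ (inj₁ (best≡ , cong (λ f j → 0 <ᵇ f j) out≡ ,
        subst₂ _≤_ tot≡ best≡ (<ᵇ-false worse)))))

  B = suc q

  Valid : (ℕ → ℕ) → Set
  Valid g = ∀ i → i < D → g i < B

  -- The guesses already tried are those numbered below `N`. The stored output is compatible with
  -- one of the guesses, and no selection compatible with a tried guess gains more.
  record BestBelow (N : ℕ) (σ : State) : Set where
    field
      {guess}    : ℕ → ℕ
      compatible : Compatible guess (outputs σ)
      attained   : gain (outputs σ) n ≡ reg σ #best
      dominates  : ∀ h → Valid h → value B h D < N → ∀ s → Compatible h s → gain s n ≤ reg σ #best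

  -- A guess newly counted as tried has the same number as `g`, hence the same digits, and
  -- `maximal-gain` applies. All others were handled before, and `#best` never decreases.
  bestBelow-suc : ∀ {σ σ′ g} s → Valid g → Compatible g s → Maximal g s → Improves σ σ′ s →
                  BestBelow (value B g D) σ → BestBelow (suc (value B g D)) σ′
  bestBelow-suc {σ} {σ′} {g} s g<B comp max imp bb = record
    { compatible = proj₂ (comp′ imp) ; attained = att imp
    ; dominates = λ h h<B h≤ s′ comp″ → dom imp h h<B (m<1+n⇒m<n∨m≡n h≤) s′ comp″ }
    where
    open BestBelow bb
    comp′ : Improves σ σ′ s → ∃ λ g′ → Compatible g′ (outputs σ′)
    comp′ (inj₁ (_ , e , _)) = _ , subst (Compatible guess) (sym e) compatible
    comp′ (inj₂ (_ , _ , e)) = g , compatible-cong e comp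
    att : Improves σ σ′ s → gain (outputs σ′) n ≡ reg σ′ #best
    att (inj₁ (b , e , _)) = trans (cong (λ s → gain s n) e) (trans attained (sym b))
    att (inj₂ (_ , b , e)) = trans (sym (gain-cong n e)) (sym b)
    old≤ : Improves σ σ′ s → reg σ #best ≤ reg σ′ #best
    old≤ (inj₁ (b , _)) = ≤-reflexive (sym b)
    old≤ (inj₂ (l , b , _)) = ≤-trans (<⇒≤ l) (≤-reflexive (sym b))
    new≤ : Improves σ σ′ s → gain s n ≤ reg σ′ #best
    new≤ (inj₁ (b , _ , l)) = ≤-trans l (≤-reflexive (sym b))
    new≤ (inj₂ (_ , b , _)) = ≤-reflexive (sym b)
    dom : Improves σ σ′ s → ∀ h → Valid h → value B h D < value B g D ⊎ value B h D ≡ value B g D →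
          ∀ s′ → Compatible h s′ → gain s′ n ≤ reg σ′ #best
    dom imp h h<B (inj₁ l) s′ c = ≤-trans (dominates h h<B l s′ c) (old≤ imp)
    dom imp h h<B (inj₂ e) s′ c =
      ≤-trans (maximal-gain (value-injective D h<B g<B e) max c) (new≤ imp)

  record Optimum (σ : State) : Set where
    field
      {guess}    : ℕ → ℕ
      compatible : Compatible guess (outputs σ)
      dominates  : ∀ h → Valid h → ∀ s → Compatible h s → gain s n ≤ gain (outputs σ) n

  runSearch : ∀ {σ M} → Env σ → (∀ i → arr σ $digit i ≡ 0) → reg σ #best ≡ 0 →
    (∀ j → arr σ $out j ≡ 0) → suc (B ^ D) * suc n ≤ M → Run M search σ Optimum
  runSearch {σ} env digit≡0 best≡0 out≡0 ≤M =
    conseq (λ { {σ′} fr (_ , stop , k , inv) → finish {σ′} {k} fr (≡ᵇ-false stop) inv })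
      (runWhile Inv (B ^ D) ≤M inv₀ step)
    where
    Inv : ℕ → State → Set
    Inv k σ′ = let g = arr σ′ $digit in
      k + value B g (suc D) ≡ B ^ D × (∀ i → i < suc D → g i < B) × BestBelow (value B g (suc D)) σ′

    value₀ : ∀ k → value B (arr σ $digit) k ≡ 0
    value₀ zero = refl
    value₀ (suc k) rewrite value₀ k | digit≡0 k = refl

    out₀ : ∀ j → outputs σ j ≡ false
    out₀ j rewrite out≡0 j = refl

    gain₀ : ∀ k → gain (outputs σ) k ≡ 0
    gain₀ zero = refl
    gain₀ (suc k) rewrite gain₀ k | out₀ k = refl

    -- The zeroed output array is the empty selection, vacuously compatible and of gain 0; no guess
    -- has a number below 0.
    inv₀ : Inv (B ^ D) σ
    inv₀ = trans (cong (B ^ D +_) (value₀ (suc D))) (+-identityʳ _) ,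
      (λ i _ → subst (_< B) (sym (digit≡0 i)) (s≤s z≤n)) ,
      record
        { guess      = λ _ → 0
        ; compatible = record
            { eligible = λ j _ t → contradiction (trans (sym t) (out₀ j)) λ()
            ; unique   = λ j _ _ _ t → contradiction (trans (sym t) (out₀ j)) λ() }
        ; attained   = trans (gain₀ n) (sym best≡0)
        ; dominates  = λ h _ l → contradiction (subst (value B h D <_) (value₀ (suc D)) l) λ() }

    value-0 : ∀ g → g D ≡ 0 → value B g (suc D) ≡ value B g D
    value-0 g e rewrite e = +-identityʳ (value B g D)

    step : ∀ k σ′ → Frame (evaluate ⨾ increment) σ σ′ → test σ′ ($digit [ var #D ] ≈ lit 0) ≡ true →
           Inv k σ′ → ∃ λ k′ → k ≡ suc k′ × Run (suc n) (evaluate ⨾ increment) σ′ (Inv k′)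
    step k σ′ fr go (eq , g<B , bb) = lemma k eq
      where
      env′ : Env σ′
      env′ = frame-env readOnly fr env
      g = arr σ′ $digit
      gD : g D ≡ 0
      gD = trans (cong g (sym (D≡ env′))) (≡ᵇ-true go)
      g<B′ : Valid g
      g<B′ i i<D = g<B i (m<n⇒m<1+n i<D)
      bb′ : BestBelow (value B g D) σ′
      bb′ = subst (λ N → BestBelow N σ′) (value-0 g gD) bb
      lemma : ∀ k → k + value B g (suc D) ≡ B ^ D →
              ∃ λ k′ → k ≡ suc k′ × Run (suc n) (evaluate ⨾ increment) σ′ (Inv k′)
      -- Exhausted fuel would mean that the number is `B ^ D`, but with digit `D` equal to 0 it is
      -- smaller.
      lemma zero eq = contradiction (trans (sym (value-0 g gD)) eq) (<⇒≢ (value-< D g<B′))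
      lemma (suc k) eq = k , refl ,
        (runEvaluate env′ ∙> λ { {σ″} fr′ (s , comp , max , imp) →
          let g≡ = onArr fr′ $digit refl in
          conseq (λ { {σ‴} fr″ (lt , v) →
              let v′ = trans v (cong (λ g → suc (value B g (suc D))) g≡) in
              trans (cong (k +_) v′) (trans (+-suc k _) eq) , lt ,
              subst (λ N → BestBelow N σ‴) (sym (trans v′ (cong suc (value-0 g gD))))
                (transport {σ₁ = σ″} fr″ (bestBelow-suc s g<B′ comp max imp bb′)) })
            (runIncrement σ″ (q≡ (frame-env readOnly fr′ env′)) q>0 (s≤s D≤n)
              (subst (λ g → ∀ i → i < suc D → g i < B) (sym g≡) g<B)
              (trans (cong (λ g → g D) g≡) gD)) })
        where
        transport : ∀ {N σ₁ σ₂} → Frame increment σ₁ σ₂ → BestBelow N σ₁ → BestBelow N σ₂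
        transport {N} {σ₁} {σ₂} fr b = record
          { compatible = subst (Compatible guess) out≡ compatible
          ; attained   = subst₂ (λ s v → gain s n ≡ v) out≡ (sym (onReg fr #best refl)) attained
          ; dominates  = λ h h<B l s c → subst (gain s n ≤_) (sym (onReg fr #best refl)) (dominates h h<B l s c) }
          where
          open BestBelow b
          out≡ : outputs σ₁ ≡ outputs σ₂
          out≡ = cong (λ f j → 0 <ᵇ f j) (sym (onArr fr $out refl))

    finish : ∀ {σ′ k} → Frame search σ σ′ → arr σ′ $digit (reg σ′ #D) ≢ 0 → Inv k σ′ → Optimum σ′
    finish {σ′} fr gD≢0 (_ , g<B , bb) = record
      { compatible = compatible
      ; dominates  = λ h h<B s c → subst (gain s n ≤_) (sym attained)
          (dominates h h<B (<-≤-trans (value-< D h<B) all) s c) }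
      where
      open BestBelow bb
      g = arr σ′ $digit
      gD>0 : 0 < g D
      gD>0 = n≢0⇒n>0 λ e → gD≢0 (trans (cong g (trans (onReg fr #D refl) (D≡ env))) e)
      -- A nonzero sentinel digit puts the number beyond those of all valid guesses, so every one of
      -- them has been tried.
      all : B ^ D ≤ value B g (suc D)
      all = begin
        B ^ D                       ≡⟨ *-identityˡ (B ^ D) ⟨
        1 * B ^ D                   ≤⟨ *-monoˡ-≤ (B ^ D) gD>0 ⟩
        g D * B ^ D                 ≤⟨ m≤n+m _ (value B g D) ⟩
        value B g (suc D)           ∎
        where open ≤-Reasoning

-- Natural numbers among the rationals

private
  lift : ∀ k → toℚᵘ (fromℕ k) ℚᵘ.≃ mkℚᵘ (int k) 0
  lift k = ℚ.toℚᵘ-fromℚᵘ (mkℚᵘ (int k) 0)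

fromℕ-+ : ∀ a b → fromℕ (a + b) ≡ fromℕ a ℚ.+ fromℕ b
fromℕ-+ a b = ℚ.toℚᵘ-injective (begin
  toℚᵘ (fromℕ (a + b))                    ≈⟨ lift (a + b) ⟩
  mkℚᵘ (int (a + b)) 0                    ≈⟨ *≡* (cong (ℤ._* int 1)
                                               (ℤ.*-identityʳ (int a) ▸ ℤ.*-identityʳ (int b))) ⟩
  mkℚᵘ (int a) 0 ℚᵘ.+ mkℚᵘ (int b) 0      ≈⟨ ℚᵘ.+-cong (lift a) (lift b) ⟨
  toℚᵘ (fromℕ a) ℚᵘ.+ toℚᵘ (fromℕ b)      ≈⟨ ℚ.toℚᵘ-homo-+ (fromℕ a) (fromℕ b) ⟨
  toℚᵘ (fromℕ a ℚ.+ fromℕ b)              ∎)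
  where
  open ℚᵘ.≃-Reasoning
  _▸_ : ∀ {x y} → x ≡ int a → y ≡ int b → int (a + b) ≡ x ℤ.+ y
  refl ▸ refl = ℤ.pos-+ a b

fromℕ-mono-≤ : ∀ {a b} → a ≤ b → fromℕ a ℚ.≤ fromℕ b
fromℕ-mono-≤ {a} {b} a≤b = ℚ.toℚᵘ-cancel-≤ (begin
  toℚᵘ (fromℕ a)  ≃⟨ lift a ⟩
  mkℚᵘ (int a) 0  ≤⟨ *≤* (ℤ.*-monoʳ-≤-nonNeg (int 1) (ℤ.+≤+ a≤b)) ⟩
  mkℚᵘ (int b) 0  ≃⟨ lift b ⟨
  toℚᵘ (fromℕ b)  ∎)
  where open ℚᵘ.≤-Reasoning

fromℕ-cancel-≤ : ∀ {a b} → fromℕ a ℚ.≤ fromℕ b → a ≤ b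
fromℕ-cancel-≤ {a} {b} a≤b = ℤ.drop‿+≤+ (ℤ.*-cancelʳ-≤-pos (int a) (int b) (int 1) (ℚᵘ.drop-*≤* (begin
  mkℚᵘ (int a) 0  ≃⟨ lift a ⟨
  toℚᵘ (fromℕ a)  ≤⟨ ℚ.toℚᵘ-mono-≤ a≤b ⟩
  toℚᵘ (fromℕ b)  ≃⟨ lift b ⟩
  mkℚᵘ (int b) 0  ∎)))
  where open ℚᵘ.≤-Reasoning

-- Disjoint intervals of rationals

module Packing {X : Set} (start : X → ℚ) (len : X → ℕ) (b : ℚ) where

  finish : X → ℚ
  finish x = start x ℚ.+ fromℕ (len x)

  Apart : X → X → Set
  Apart x y = finish x ℚ.≤ start y ⊎ finish y ℚ.≤ start x

  data Chain : ℚ → List X → Set where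
    []  : ∀ {a} → a ℚ.≤ b → Chain a []
    _∷_ : ∀ {a x xs} → a ℚ.≤ start x → Chain (finish x) xs → Chain a (x ∷ xs)

  -- Disjointness does the work of a comparison: the disjunct of `Apart` tells on which side of `y`
  -- the interval `x` belongs.
  insert : ∀ {a x xs} → a ℚ.≤ start x → finish x ℚ.≤ b → All (Apart x) xs → Chain a xs →
           ∃ λ ys → ys ↭ x ∷ xs × Chain a ys
  insert a≤ ≤b []               ([] _)   = _ , ↭-refl , a≤ ∷ [] ≤b
  insert a≤ ≤b (inj₁ x≤y ∷ _)   (_ ∷ ch) = _ , ↭-refl , a≤ ∷ x≤y ∷ ch
  insert {x = x} a≤ ≤b (inj₂ y≤x ∷ aps) (_∷_ {x = y} a≤y ch) with insert y≤x ≤b aps ch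
  ... | ys , perm , ch′ = y ∷ ys , ↭-trans (prep y perm) (swap y x ↭-refl) , a≤y ∷ ch′

  sort : ∀ {a} xs → a ℚ.≤ b → All (λ x → a ℚ.≤ start x × finish x ℚ.≤ b) xs → AllPairs Apart xs →
         ∃ λ ys → ys ↭ xs × Chain a ys
  sort []       a≤b []                aps        = [] , ↭-refl , [] a≤b
  sort (x ∷ xs) a≤b ((a≤ , ≤b) ∷ ins) (ap ∷ aps) with sort xs a≤b ins aps
  ... | ys , perm , ch with insert a≤ ≤b (All-resp-↭ (↭-sym perm) ap) ch
  ... | zs , perm′ , ch′ = zs , ↭-trans perm′ (prep x perm) , ch′

  chain-length : ∀ {a} xs → Chain a xs → a ℚ.+ fromℕ (sum (map len xs)) ℚ.≤ b
  chain-length {a} [] ([] a≤b) = subst (ℚ._≤ b) (sym (ℚ.+-identityʳ a)) a≤b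
  chain-length {a} (x ∷ xs) (a≤ ∷ ch) = begin
    a ℚ.+ fromℕ (len x + S)             ≡⟨ cong (a ℚ.+_) (fromℕ-+ (len x) S) ⟩
    a ℚ.+ (fromℕ (len x) ℚ.+ fromℕ S)   ≡⟨ ℚ.+-assoc a _ _ ⟨
    a ℚ.+ fromℕ (len x) ℚ.+ fromℕ S     ≤⟨ ℚ.+-monoˡ-≤ (fromℕ S) (ℚ.+-monoˡ-≤ (fromℕ (len x)) a≤) ⟩
    finish x ℚ.+ fromℕ S                ≤⟨ chain-length xs ch ⟩
    b                                   ∎
    where
    open ℚ.≤-Reasoning
    S = sum (map len xs)

  -- Once the intervals are sorted, each begins after the end of the one before, and the lengths add
  -- up along the chain; their sum does not depend on the order.
  total-length : ∀ {a} xs → a ℚ.≤ b → All (λ x → a ℚ.≤ start x × finish x ℚ.≤ b) xs →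
                 AllPairs Apart xs → a ℚ.+ fromℕ (sum (map len xs)) ℚ.≤ b
  total-length {a} xs a≤b ins aps with sort xs a≤b ins aps
  ... | ys , perm , ch = subst (λ S → a ℚ.+ fromℕ S ℚ.≤ b) (sum-↭ (map⁺ len perm)) (chain-length ys ch)

-- Compatible selections against schedules

table-toℕ : ∀ {n} (f : Fin n → ℕ) j → table f (toℕ j) ≡ f j
table-toℕ {n} f j with toℕ j <? n
... | yes j<n = cong f (fromℕ<-toℕ j j<n)
... | no  j≮n = contradiction (toℕ<n j) j≮n

sumTo-head : ∀ k f → sumTo (suc k) f ≡ f 0 + sumTo k (λ j → f (suc j))
sumTo-head zero    f = sym (+-identityʳ (f 0))
sumTo-head (suc k) f = trans (cong (_+ f (suc k)) (sumTo-head k f)) (+-assoc (f 0) _ _)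

∑≡sumTo : ∀ n (f : Fin n → ℕ) g → (∀ j → f j ≡ g (toℕ j)) → ∑ n f ≡ sumTo n g
∑≡sumTo zero    f g e = refl
∑≡sumTo (suc n) f g e = trans (cong₂ _+_ (e zero) (∑≡sumTo n _ (λ j → g (suc j)) (λ j → e (suc j))))
                              (sym (sumTo-head n g))

module Scheduling (I : FlowShop 2) (D q : ℕ) (dues procs : ℕ → ℕ) where

  open FlowShop I

  due = table d
  wt  = table w
  p₁  = table (p zero)
  p₂  = table (p (suc zero))

  open Guessing n D due wt p₁ p₂ dues procs

  weight≡gain : ∀ S s → (∀ j → s (toℕ j) ≡ Vec.lookup S j) → weight I S ≡ gain s n
  weight≡gain S s e = ∑≡sumTo n _ _ λ j →
    cong₂ (λ b v → if b then v else 0) (sym (e j)) (sym (table-toℕ w j))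

  load-mono : ∀ g {i k} → i ≤ k → load g i ≤ load g k
  load-mono g {k = k} i≤k with m≤n⇒m<n∨m≡n i≤k
  ... | inj₂ refl = ≤-refl
  load-mono g {k = suc k} i≤k | inj₁ i<1+k = ≤-trans (load-mono g (s≤s⁻¹ i<1+k)) (m≤m+n _ _)

  lastDue-≥ : ∀ g {l} i → l < i → i ≤ D → Enumeration due n D dues → 0 < procs (g l) → dues (suc l) ≤ lastDue g i
  lastDue-≥ g {l} (suc i) l≤i i≤D E pos with m<1+n⇒m<n∨m≡n l≤i | 0 <ᵇ procs (g i) in eq
  ... | inj₁ l<i | true  = <⇒≤ (enumeration-< E (s≤s l<i) i≤D)
  ... | inj₁ l<i | false = lastDue-≥ g i l<i (<⇒≤ i≤D) E pos
  ... | inj₂ refl | true  = ≤-refl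
  ... | inj₂ refl | false = contradiction pos (≤⇒≯ (<ᵇ-false eq))

  lastDue-attained : ∀ g i → lastDue g i ≡ 0 ⊎
    ∃ λ l → l < i × lastDue g i ≡ dues (suc l) × procs (g l) ≢ 0
  lastDue-attained g zero = inj₁ refl
  lastDue-attained g (suc i) with 0 <ᵇ procs (g i) in eq
  ... | true = inj₂ (i , ≤-refl , refl , λ e → contradiction (subst (0 <_) e (<ᵇ-true eq)) λ())
  ... | false with lastDue-attained g i
  ...   | inj₁ e = inj₁ e
  ...   | inj₂ (l , l<i , h) = inj₂ (l , m<n⇒m<1+n l<i , h)

  module _ (E : Enumeration due n D dues) (cover : ∀ j → j < n → ∃ λ i → i < D × due j ≡ dues (suc i)) where

    -- A compatible selection is scheduled without idle time on M₁, and as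
    -- late as possible on M₂.
    compatible⇒schedule : ∀ {g s} S → (∀ j → s (toℕ j) ≡ Vec.lookup S j) → Compatible g s → JITSchedule I S
    compatible⇒schedule {g} {s} S s≡ C = record
      { start     = λ i j → fromℕ (begins i j)
      ; available = λ i {j} _ → fromℕ-mono-≤ {0} {begins i j} z≤n
      ; route     = route
      ; disjoint  = disjoint
      ; jit       = λ { {suc zero} _ j∈S → trans (ends (suc zero) _) (cong fromℕ (m∸n+n≡m (p₂≤d j∈S))) }
      }
      where
      open Compatible C
      rank : Fin n → ℕ
      rank j = proj₁ (cover (toℕ j) (toℕ<n j))
      rank<D : ∀ j → rank j < D
      rank<D j = proj₁ (proj₂ (cover (toℕ j) (toℕ<n j)))
      d≡ : ∀ j → d j ≡ dues (suc (rank j))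
      d≡ j = trans (sym (table-toℕ d j)) (proj₂ (proj₂ (cover (toℕ j) (toℕ<n j))))

      begins : Fin 2 → Fin n → ℕ
      begins zero       j = load g (rank j)
      begins (suc zero) j = d j ∸ p (suc zero) j

      ends : ∀ i j → fromℕ (begins i j) ℚ.+ fromℕ (p i j) ≡ fromℕ (begins i j + p i j)
      ends i j = sym (fromℕ-+ (begins i j) (p i j))

      chosen : ∀ {j} → j ∈ S → s (toℕ j) ≡ true
      chosen {j} j∈S = trans (s≡ j) ([]=⇒lookup j∈S)

      fits : ∀ {j} → j ∈ S → p zero j ≡ procs (g (rank j)) ×
        load g (suc (rank j)) + p (suc zero) j ≤ d j × lastDue g (rank j) + p (suc zero) j ≤ d j
      fits {j} j∈S with eligible (toℕ j) (toℕ<n j) (chosen j∈S)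
      -- Eligibility brings its own rank `i`; as the due dates are listed without repetition, it is
      -- `rank j`.
      ... | i , i<D , e , pe , l , r with suc-injective (enumeration-injective E i<D (rank<D j)
              (trans (sym e) (trans (table-toℕ d j) (d≡ j))))
      ...   | refl rewrite table-toℕ d j | table-toℕ (p zero) j | table-toℕ (p (suc zero)) j = pe , l , r

      p₂≤d : ∀ {j} → j ∈ S → p (suc zero) j ≤ d j
      p₂≤d j∈S = ≤-trans (m≤n+m _ _) (proj₁ (proj₂ (fits j∈S)))

      end₁ : ∀ {j} → j ∈ S → begins zero j + p zero j ≡ load g (suc (rank j))
      end₁ {j} j∈S = cong (load g (rank j) +_) (proj₁ (fits j∈S))

      ℕ⇒ℚ : ∀ i {j x} → begins i j + p i j ≤ x → fromℕ (begins i j) ℚ.+ fromℕ (p i j) ℚ.≤ fromℕ x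
      ℕ⇒ℚ i {j} {x} l = subst (ℚ._≤ fromℕ x) (sym (ends i j)) (fromℕ-mono-≤ l)

      route : ∀ {i i′} → toℕ i′ ≡ suc (toℕ i) → ∀ {j} → j ∈ S →
              fromℕ (begins i j) ℚ.+ fromℕ (p i j) ℚ.≤ fromℕ (begins i′ j)
      route {zero} {suc zero} _ {j} j∈S = ℕ⇒ℚ zero
        (subst (_≤ d j ∸ p (suc zero) j) (sym (end₁ j∈S)) (m+n≤o⇒m≤o∸n _ (proj₁ (proj₂ (fits j∈S)))))
      route {suc zero} {zero} ()
      route {suc zero} {suc zero} ()

      ordered : ∀ i {j j′} → j ∈ S → j′ ∈ S → rank j < rank j′ → begins i j + p i j ≤ begins i j′
      ordered zero {j′ = j′} j∈S j′∈S l = subst (_≤ load g (rank j′)) (sym (end₁ j∈S)) (load-mono g l)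
      -- The time of `j` on M₁ is positive, so its guess counts as in use and its due date enters
      -- `lastDue` at every higher rank.
      ordered (suc zero) {j} {j′} j∈S j′∈S l = begin
        d j ∸ p (suc zero) j + p (suc zero) j  ≡⟨ m∸n+n≡m (p₂≤d j∈S) ⟩
        d j                                    ≡⟨ d≡ j ⟩
        dues (suc (rank j))                    ≤⟨ lastDue-≥ g (rank j′) l (<⇒≤ (rank<D j′)) E
                                                    (subst (0 <_) (proj₁ (fits j∈S)) (p>0 zero j)) ⟩
        lastDue g (rank j′)                    ≤⟨ m+n≤o⇒m≤o∸n _ (proj₂ (proj₂ (fits j′∈S))) ⟩
        d j′ ∸ p (suc zero) j′                 ∎
        where open ≤-Reasoning

      disjoint : ∀ i {j j′} → j ∈ S → j′ ∈ S → j ≢ j′ →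
        fromℕ (begins i j) ℚ.+ fromℕ (p i j) ℚ.≤ fromℕ (begins i j′) ⊎
        fromℕ (begins i j′) ℚ.+ fromℕ (p i j′) ℚ.≤ fromℕ (begins i j)
      disjoint i {j} {j′} j∈S j′∈S j≢j′ with <-cmp (rank j) (rank j′)
      ... | tri< l _ _ = inj₁ (ℕ⇒ℚ i (ordered i j∈S j′∈S l))
      ... | tri> _ _ l = inj₂ (ℕ⇒ℚ i (ordered i j′∈S j∈S l))
      ... | tri≈ _ e _ = contradiction (toℕ-injective (unique _ _ (toℕ<n j) (toℕ<n j′) (chosen j∈S) (chosen j′∈S)
              (trans (table-toℕ d j) (trans (d≡ j) (trans (cong (λ r → dues (suc r)) e)
                (sym (trans (table-toℕ d j′) (d≡ j′)))))))) j≢j′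

    -- Passing through a table of 0s and 1s makes the default 0 of `table` declare every index
    -- beyond `n` a non-member.
    members : Subset n → ℕ → Bool
    members S x = 0 <ᵇ table (λ j → if Vec.lookup S j then 1 else 0) x

    members≡ : ∀ S j → members S (toℕ j) ≡ Vec.lookup S j
    members≡ S j rewrite table-toℕ (λ j → if Vec.lookup S j then 1 else 0) j with Vec.lookup S j
    ... | true  = refl
    ... | false = refl

    module _ (procs₀ : procs 0 ≡ 0) (cover₁ : ∀ j → j < n → ∃ λ r → r < q × p₁ j ≡ procs (suc r))
             {S : Subset n} (sched : JITSchedule I S) where

      open JITSchedule sched

      private
        M₁ M₂ : Fin 2
        M₁ = zero
        M₂ = suc zero

      Serves : ℕ → ℕ → Set
      Serves x i = (∃ λ j → j ∈ S × d j ≡ dues (suc i) × procs x ≡ p M₁ j) ⊎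
                   ((∀ j → j ∈ S → d j ≢ dues (suc i)) × procs x ≡ 0)

      serve : ∀ i → ∃ λ x → x < suc q × Serves x i
      serve i with any? (λ j → (j ∈? S) ×-dec (d j ≟ dues (suc i)))
      ... | no  none = 0 , s≤s z≤n , inj₂ ((λ j j∈S e → none (j , j∈S , e)) , procs₀)
      ... | yes (j , j∈S , e) with cover₁ (toℕ j) (toℕ<n j)
      ...   | r , r<q , pe = suc r , s≤s r<q , inj₁ (j , j∈S , e , trans (sym pe) (table-toℕ (p M₁) j))

      -- The guess read off the schedule. With it the optimum over all guesses bounds the weight of
      -- any feasible set.
      followed : ℕ → ℕ
      followed i = proj₁ (serve i)

      before : ∀ {j j′} → j ∈ S → j′ ∈ S → finish M₂ j ℚ.≤ start M₂ j′ → d j + p M₂ j′ ≤ d j′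
      before {j} {j′} j∈S j′∈S l = fromℕ-cancel-≤ (begin
        fromℕ (d j + p M₂ j′)             ≡⟨ fromℕ-+ (d j) (p M₂ j′) ⟩
        fromℕ (d j) ℚ.+ fromℕ (p M₂ j′)   ≡⟨ cong (ℚ._+ fromℕ (p M₂ j′)) (jit refl j∈S) ⟨
        finish M₂ j ℚ.+ fromℕ (p M₂ j′)   ≤⟨ ℚ.+-monoˡ-≤ (fromℕ (p M₂ j′)) l ⟩
        finish M₂ j′                      ≡⟨ jit refl j′∈S ⟩
        fromℕ (d j′)                      ∎)
        where open ℚ.≤-Reasoning hiding (start)

      ¬before : ∀ {j j′} → j ∈ S → j′ ∈ S → d j′ ≤ d j → ¬ finish M₂ j ℚ.≤ start M₂ j′
      ¬before {j} {j′} j∈S j′∈S d≤ l = <⇒≱ (m<m+n (d j) (p>0 M₂ j′)) (≤-trans (before j∈S j′∈S l) d≤)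

      -- Both jobs would complete on M₂ at the same moment, and with positive processing times
      -- neither can then precede the other.
      sameDue⇒≡ : ∀ {j j′} → j ∈ S → j′ ∈ S → d j ≡ d j′ → j ≡ j′
      sameDue⇒≡ {j} {j′} j∈S j′∈S e with j Fin.≟ j′
      ... | yes eq = eq
      ... | no ne with disjoint M₂ j∈S j′∈S ne
      ...   | inj₁ l = contradiction l (¬before j∈S j′∈S (≤-reflexive (sym e)))
      ...   | inj₂ l = contradiction l (¬before j′∈S j∈S (≤-reflexive e))

      earlier : ∀ {j j′} → j ∈ S → j′ ∈ S → d j < d j′ → finish M₂ j ℚ.≤ start M₂ j′
      earlier {j} {j′} j∈S j′∈S d< with disjoint M₂ j∈S j′∈S (λ { refl → <-irrefl refl d< })
      ... | inj₁ l = l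
      ... | inj₂ l = contradiction l (¬before j′∈S j∈S (<⇒≤ d<))

      -- Turns the load, a sum over due dates, into a total over a list of jobs, the form that
      -- `total-length` takes. Distinctness is recorded through the due dates, because a new job is
      -- due strictly after all earlier ones.
      served : ∀ i → i ≤ D → ∃ λ L → sum (map (p M₁) L) ≡ load followed i ×
        All (λ j → j ∈ S × d j ≤ dues i) L × AllPairs (λ j j′ → d j ≢ d j′) L
      served zero _ = [] , refl , [] , []
      served (suc i) i<D with served i (<⇒≤ i<D) | proj₂ (proj₂ (serve i))
      ... | L , total , ins , apart | inj₂ (_ , x≡0) = L ,
        trans total (trans (sym (+-identityʳ _)) (cong (load followed i +_) (sym x≡0))) ,
        All.map (λ (j∈S , l) → j∈S , ≤-trans l (<⇒≤ (Enumeration.incr E i i<D))) ins , apart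
      ... | L , total , ins , apart | inj₁ (j , j∈S , e , x≡p) = j ∷ L ,
        trans (+-comm (p M₁ j) _) (cong₂ _+_ total (sym x≡p)) ,
        (j∈S , ≤-reflexive e) ∷ All.map (λ (j∈S , l) → j∈S , ≤-trans l (<⇒≤ (Enumeration.incr E i i<D))) ins ,
        All.map (λ (_ , l) e′ → <⇒≢ (≤-<-trans l (Enumeration.incr E i i<D)) (trans (sym e′) e)) ins ∷ apart

      -- The jobs of S due no later than j occupy disjoint intervals of M₁, all
      -- of them before j starts on M₂.
      load-fits : ∀ {j i} → j ∈ S → i < D → d j ≡ dues (suc i) → load followed (suc i) + p M₂ j ≤ d j
      load-fits {j} {i} j∈S i<D e with served (suc i) i<D
      ... | L , total , ins , apart = fromℕ-cancel-≤ (begin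
        fromℕ (load followed (suc i) + p M₂ j)                ≡⟨ fromℕ-+ (load followed (suc i)) (p M₂ j) ⟩
        fromℕ (load followed (suc i)) ℚ.+ fromℕ (p M₂ j)      ≤⟨ ℚ.+-monoˡ-≤ (fromℕ (p M₂ j)) packed ⟩
        finish M₂ j                                           ≡⟨ jit refl j∈S ⟩
        fromℕ (d j)                                           ∎)
        where
        open ℚ.≤-Reasoning hiding (start)
        open Packing (start M₁) (p M₁) (start M₂ j) using (total-length)
        -- A job due strictly earlier has left even M₂ before `j` starts there; a job due at the
        -- same time is `j` itself, and its route applies.
        early : ∀ {j′} → j′ ∈ S → d j′ ≤ dues (suc i) → finish M₁ j′ ℚ.≤ start M₂ j
        early {j′} j′∈S l with m≤n⇒m<n∨m≡n (subst (d j′ ≤_) (sym e) l)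
        ... | inj₂ e′ with sameDue⇒≡ j′∈S j∈S e′
        ...   | refl = route refl j∈S
        early {j′} j′∈S l | inj₁ d< = begin
          finish M₁ j′                          ≤⟨ route refl j′∈S ⟩
          start M₂ j′                           ≡⟨ ℚ.+-identityʳ (start M₂ j′) ⟨
          start M₂ j′ ℚ.+ 0ℚ                    ≤⟨ ℚ.+-monoʳ-≤ (start M₂ j′) (fromℕ-mono-≤ {0} {p M₂ j′} z≤n) ⟩
          finish M₂ j′                          ≤⟨ earlier j′∈S j∈S d< ⟩
          start M₂ j                            ∎
        apart′ : ∀ {L} → All (λ j → j ∈ S × d j ≤ dues (suc i)) L → AllPairs (λ j j′ → d j ≢ d j′) L →
                 AllPairs (λ j j′ → finish M₁ j ℚ.≤ start M₁ j′ ⊎ finish M₁ j′ ℚ.≤ start M₁ j) L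
        apart′ [] [] = []
        apart′ ((j∈S , _) ∷ ins) (ne ∷ nes) =
          All.zipWith (λ ((j′∈S , _) , d≢) → disjoint M₁ j∈S j′∈S λ { refl → d≢ refl }) (ins , ne) ∷ apart′ ins nes
        packed : fromℕ (load followed (suc i)) ℚ.≤ start M₂ j
        packed = begin
          fromℕ (load followed (suc i))         ≡⟨ cong fromℕ total ⟨
          fromℕ (sum (map (p M₁) L))            ≡⟨ ℚ.+-identityˡ _ ⟨
          0ℚ ℚ.+ fromℕ (sum (map (p M₁) L))     ≤⟨ total-length L (available M₂ j∈S)
                                                     (All.map (λ (j′∈S , l) → available M₁ j′∈S , early j′∈S l) ins)
                                                     (apart′ ins apart) ⟩
          start M₂ j                            ∎

      lastDue-fits : ∀ {j i} → j ∈ S → i < D → d j ≡ dues (suc i) → lastDue followed i + p M₂ j ≤ d j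
      lastDue-fits {j} {i} j∈S i<D e with lastDue-attained followed i
      -- With no earlier due date in use, what remains is that `p M₂ j` is at most `d j`, a part of
      -- `load-fits`.
      ... | inj₁ l≡0 rewrite l≡0 = ≤-trans (m≤n+m _ (load followed (suc i))) (load-fits j∈S i<D e)
      ... | inj₂ (l , l<i , l≡ , x≢0) with proj₂ (proj₂ (serve l))
      ...   | inj₂ (_ , x≡0) = contradiction x≡0 x≢0
      ...   | inj₁ (j′ , j′∈S , e′ , _) = subst (λ x → x + p M₂ j ≤ d j) (trans e′ (sym l≡))
        (before j′∈S j∈S (earlier j′∈S j∈S (subst₂ _<_ (sym e′) (sym e) (enumeration-< E (s≤s l<i) i<D))))

      schedule⇒compatible : Compatible followed (members S)
      schedule⇒compatible = record
        { eligible = λ x x<n t → subst (Eligible followed) (toℕ-fromℕ< x<n)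
            (elig (fromℕ< x<n) (∈S x<n t))
        ; unique = λ x x′ x<n x′<n t t′ e → trans (sym (toℕ-fromℕ< x<n)) (trans
            (cong toℕ (sameDue⇒≡ (∈S x<n t) (∈S x′<n t′) (trans (sym (d≡ x<n)) (trans e (d≡ x′<n)))))
            (toℕ-fromℕ< x′<n))
        }
        where
        ∈S : ∀ {x} (x<n : x < n) → members S x ≡ true → fromℕ< x<n ∈ S
        ∈S x<n t = lookup⇒[]= _ S (trans (sym (members≡ S (fromℕ< x<n)))
                     (trans (cong (members S) (toℕ-fromℕ< x<n)) t))
        d≡ : ∀ {x} (x<n : x < n) → due x ≡ d (fromℕ< x<n)
        d≡ x<n = trans (cong due (sym (toℕ-fromℕ< x<n))) (table-toℕ d (fromℕ< x<n))
        elig : ∀ j → j ∈ S → Eligible followed (toℕ j)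
        elig j j∈S with cover (toℕ j) (toℕ<n j)
        ... | i , i<D , e rewrite table-toℕ d j | table-toℕ (p M₁) j | table-toℕ (p M₂) j =
          i , i<D , e , first (proj₂ (proj₂ (serve i))) , load-fits j∈S i<D e , lastDue-fits j∈S i<D e
          where
          first : Serves (followed i) i → p M₁ j ≡ procs (followed i)
          first (inj₂ (none , _)) = contradiction e (none j j∈S)
          first (inj₁ (j′ , j′∈S , e′ , x≡p)) with sameDue⇒≡ j∈S j′∈S (trans e (sym e′))
          ... | refl = sym x≡p

-- Counting bounds

-- Pigeonhole: different values sit at different positions of `xs`. The deduplicated list of values
-- yields the bound by `#distinct`, the full list the bound by `n`.
enumeration-≤-length : ∀ {f n c g} → Enumeration f n c g →
  (xs : List ℕ) → (∀ j → j < n → f j List.∈ xs) → c ≤ length xs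
enumeration-≤-length {c = c} {g} E xs f∈ = injective⇒≤ {f = position} λ {i} {i′} eq →
  toℕ-injective (suc-injective (enumeration-injective E (toℕ<n i) (toℕ<n i′)
    (trans (found i) (trans (cong (lookup xs) eq) (sym (found i′))))))
  where
  member : ∀ i → g (suc (toℕ i)) List.∈ xs
  member i = let j , j<n , e = Enumeration.from E (toℕ i) (toℕ<n i) in subst (List._∈ xs) e (f∈ j j<n)
  position : Fin c → Fin (length xs)
  position i = Any.index (member i)
  found : ∀ i → g (suc (toℕ i)) ≡ lookup xs (position i)
  found i = lookup-index (member i)

module _ {n} (f : Fin n → ℕ) where

  table≡ : ∀ {x} (x<n : x < n) → table f x ≡ f (fromℕ< x<n)
  table≡ x<n = trans (cong (table f) (sym (toℕ-fromℕ< x<n))) (table-toℕ f (fromℕ< x<n))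

  table-pos : (∀ j → 0 < f j) → ∀ x → x < n → 0 < table f x
  table-pos f>0 x x<n = subst (0 <_) (sym (table≡ x<n)) (f>0 _)

  table∈ : ∀ x → x < n → table f x List.∈ tabulate f
  table∈ x x<n = subst (List._∈ tabulate f) (sym (table≡ x<n)) (∈-tabulate⁺ (fromℕ< x<n))

  table∈distinct : ∀ x → x < n → table f x List.∈ deduplicate _≟_ (tabulate f)
  table∈distinct x x<n = ∈-deduplicate⁺ _≟_ (table∈ x x<n)

  #distinct-pos : 0 < n → 0 < #distinct f
  #distinct-pos n>0 = ∈-length (table∈distinct 0 n>0)

  enumeration-≤-#distinct : ∀ c g → Enumeration (table f) n c g → c ≤ #distinct f
  enumeration-≤-#distinct c g E = enumeration-≤-length E _ table∈distinct

  enumeration-≤-n : ∀ {c g} → Enumeration (table f) n c g → c ≤ n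
  enumeration-≤-n {c} E = subst (c ≤_) (length-tabulate f) (enumeration-≤-length E _ table∈)

n<2^n : ∀ n → n < 2 ^ n
n<2^n zero    = ≤-refl
n<2^n (suc n) = begin-strict
  suc n            <⟨ +-mono-≤-< (m^n>0 2 n) (n<2^n n) ⟩
  2 ^ n + 2 ^ n    ≡⟨ cong (2 ^ n +_) (+-identityʳ (2 ^ n)) ⟨
  2 ^ suc n        ∎
  where open ≤-Reasoning

-- From `suc q ≤ 2 ^ q`: a digit in base `suc q` is worth at most `q` bits, so the code for "no job"
-- does not spoil the exponent.
[1+q]^D≤2^dp : ∀ {q D a b} → D ≤ a → q ≤ b → suc q ^ D ≤ 2 ^ (a * b)
[1+q]^D≤2^dp {q} {D} {a} {b} D≤a q≤b = begin
  suc q ^ D      ≤⟨ ^-monoˡ-≤ D (n<2^n q) ⟩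
  (2 ^ q) ^ D    ≡⟨ ^-*-assoc 2 q D ⟩
  2 ^ (q * D)    ≤⟨ ^-monoʳ-≤ 2 (≤-trans (*-mono-≤ q≤b D≤a) (≤-reflexive (*-comm b a))) ⟩
  2 ^ (a * b)    ∎
  where open ≤-Reasoning

-- The whole algorithm

solve : Cmd
solve =
  distinct $due $dues ⨾ #D ≔ var #c ⨾
  distinct $p₁ $procs ⨾ #q ≔ var #c ⨾
  search

-- Array `4 + a` is reserved for the machine with index `2 + a`, which does not exist among two
-- machines, so the default 0 of `table` appears.
load-zero : (I : FlowShop 2) → ∀ a x → arr (loadFlowShop I) (4 + a) x ≡ 0
load-zero I a x with x <? FlowShop.n I
... | no  _ = refl
... | yes x<n with 2 + a <? 2
...   | no  _ = refl
...   | yes (s≤s (s≤s ()))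

module _ (I : FlowShop 2) where

  open FlowShop I

  private
    k = #d I * #p zero I
    -- The factor 4 absorbs two successors in `scale`: `suc x ≤ 2 * 2 ^ k` and, since `n` is
    -- positive, `suc n ≤ 2 * n`.
    M = 4 * (n * 2 ^ k)
    σ₀ = loadFlowShop I

    scale : ∀ {x} → x ≤ 2 ^ k → suc x * suc n ≤ M
    scale {x} x≤ = begin
      suc x * suc n             ≤⟨ *-mono-≤ (1+≤2* x≤ (m^n>0 2 k)) (1+≤2* ≤-refl n>0) ⟩
      (2 * 2 ^ k) * (2 * n)     ≡⟨ [m*n]*[o*p]≡[m*o]*[n*p] 2 (2 ^ k) 2 n ⟩
      4 * (2 ^ k * n)           ≡⟨ cong (4 *_) (*-comm (2 ^ k) n) ⟩
      M                         ∎
      where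
      open ≤-Reasoning
      1+≤2* : ∀ {a b} → a ≤ b → 0 < b → suc a ≤ 2 * b
      1+≤2* {a} {b} a≤b b>0 = +-mono-≤ b>0 (≤-trans a≤b (m≤m+n b 0))

    -- Keeps the scans for the due dates within the budget: `#d I ≤ k`, because an instance has at
    -- least one job and so `#p zero I` is positive.
    d≤ : #d I ≤ 2 ^ k
    d≤ = ≤-trans (<⇒≤ (n<2^n (#d I)))
      (^-monoʳ-≤ 2 (m≤m*n (#d I) (#p zero I) {{>-nonZero (#distinct-pos (p zero) n>0)}}))

    p≤ : #p zero I ≤ 2 ^ k
    p≤ = ≤-trans (<⇒≤ (n<2^n (#p zero I)))
      (^-monoʳ-≤ 2 (m≤n*m (#p zero I) (#d I) {{>-nonZero (#distinct-pos d n>0)}}))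

    instance
      M≢0 : NonZero M
      M≢0 = >-nonZero (≤-trans (s≤s z≤n) (scale z≤n))

  runOptimalSearch : ∀ {σ} →
    let D = reg σ #D ; q = reg σ #q ; dues = arr σ $dues ; procs = arr σ $procs in
    reg σ #n ≡ n → arr σ $due ≡ table d → arr σ $wt ≡ table w →
    arr σ $p₁ ≡ table (p zero) → arr σ $p₂ ≡ table (p (suc zero)) →
    Enumeration (table d) n D dues → (∀ j → j < n → table d j ≤ dues D) →
    Enumeration (table (p zero)) n q procs → (∀ j → j < n → table (p zero) j ≤ procs q) →
    (∀ i → arr σ $digit i ≡ 0) → reg σ #best ≡ 0 → (∀ j → arr σ $out j ≡ 0) →
    Run M search σ λ σ′ → Optimal I (output I σ′)
  runOptimalSearch {σ} n≡ due≡ wt≡ p₁≡ p₂≡ E d≤max E₁ p≤max digit≡0 best≡0 out≡0 =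
    conseq (λ {σ′} _ → optimal σ′)
      (runSearch env digit≡0 best≡0 out≡0
        (scale ([1+q]^D≤2^dp (enumeration-≤-#distinct d _ _ E) (enumeration-≤-#distinct (p zero) _ _ E₁))))
    where
    D = reg σ #D
    q = reg σ #q
    dues = arr σ $dues
    procs = arr σ $procs
    cover : ∀ j → j < n → ∃ λ i → i < D × table d j ≡ dues (suc i)
    cover j j<n = Enumeration.covers E j j<n (d≤max j j<n)
    cover₁ : ∀ j → j < n → ∃ λ r → r < q × table (p zero) j ≡ procs (suc r)
    cover₁ j j<n = Enumeration.covers E₁ j j<n (p≤max j j<n)
    q>0 : 0 < q
    q>0 = ≤-trans (s≤s z≤n) (proj₁ (proj₂ (cover₁ 0 n>0)))

    open Scheduling I D q dues procs
    open Searching n D q due wt p₁ p₂ dues procs E cover (table-pos w w>0) (enumeration-≤-n d E) q>0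

    env : Env σ
    env = record
      { n≡ = n≡ ; D≡ = refl ; q≡ = refl ; due≡ = due≡ ; wt≡ = wt≡ ; p₁≡ = p₁≡ ; p₂≡ = p₂≡
      ; dues≡ = refl ; procs≡ = refl }

    optimal : ∀ σ′ → Optimum σ′ → Optimal I (output I σ′)
    -- Compatibility of the output gives its schedule; a rival is bounded through the guess that its
    -- own schedule follows.
    optimal σ′ opt =
      compatible⇒schedule E cover S out≡ compatible ,
      λ E′ sched → subst₂ _≤_ (sym (weight≡gain E′ (members E cover E′) (members≡ E cover E′)))
                              (sym (weight≡gain S (outputs σ′) out≡))
        (dominates _ (λ i _ → proj₁ (proj₂ (serve E cover base cover₁ sched i))) _
          (schedule⇒compatible E cover base cover₁ sched))
      where
      open Optimum opt
      open Enumeration E₁ using (base)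
      S = output I σ′
      out≡ = λ j → sym (lookup∘tabulate (λ j → 0 <ᵇ arr σ′ 4 (toℕ j)) j)

  runSolve : Run (4 * (n * 2 ^ (#d I * #p zero I))) solve (loadFlowShop I) λ σ → Optimal I (output I σ)
  runSolve =
    runDistinct $due $dues σ₀ (#d I) refl refl refl (load-zero I 1 0)
      (table-pos d d>0) (enumeration-≤-#distinct d) (scale d≤) ∙> λ {σ₁} fr₁ (E , d≤max) →
    runSeq $ runReg $
    runDistinct $p₁ $procs (setReg σ₁ #D (reg σ₁ #c)) (#p zero I)
      (onArr fr₁ $p₁ refl) (onReg fr₁ #n refl) refl
      (trans (cong (λ f → f 0) (onArr fr₁ $procs refl)) (load-zero I 2 0))
      (table-pos (p zero) (p>0 zero)) (enumeration-≤-#distinct (p zero)) (scale p≤) ∙> λ {σ₂} fr₂ (E₁ , p≤max) →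
    runSeq $ runReg $
    let σ₃ = setReg σ₂ #q (reg σ₂ #c)
        D≡ = onReg fr₂ #D refl
        dues≡ = onArr fr₂ $dues refl
        same : ∀ a → writesₐ (distinct $due $dues) a ≡ false → writesₐ (distinct $p₁ $procs) a ≡ false →
               arr σ₃ a ≡ arr σ₀ a
        same a e e′ = trans (onArr fr₂ a e′) (onArr fr₁ a e)
        zeros : ∀ a → arr σ₃ (4 + a) ≡ arr σ₀ (4 + a) → ∀ x → arr σ₃ (4 + a) x ≡ 0
        zeros a e x = trans (cong (λ f → f x) e) (load-zero I a x)
    in runOptimalSearch {σ₃}
      (trans (onReg fr₂ #n refl) (onReg fr₁ #n refl))
      (same $due refl refl) (same $wt refl refl) (same $p₁ refl refl) (same $p₂ refl refl)
      (subst₂ (Enumeration (table d) n) (sym D≡) (sym dues≡) E)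
      (subst₂ (λ D g → ∀ j → j < n → table d j ≤ g D) (sym D≡) (sym dues≡) d≤max)
      E₁ p≤max
      (zeros 3 (same $digit refl refl))
      (trans (onReg fr₂ #best refl) (onReg fr₁ #best refl))
      (zeros 0 (same $out refl refl))

-- The fixed-parameter bound

-- 2 ^ 2 ^ κ bounds 2 ^ (#d * #p) and is computed by doublings alone.
double : Cmd
double = while (lit 0 ≺ var 0) (1 ≔ var 1 ⊕ var 1 ⨾ 0 ≔ var 0 ⊖ lit 1)

⇓double : ∀ k σ → reg σ 0 ≡ k →
  ∃ λ t → ∃ λ σ′ → (⟨ double , σ ⟩⇓[ t ] σ′) × reg σ′ 1 ≡ reg σ 1 * 2 ^ k
⇓double zero σ e = _ , σ , ⇓exit (cong (0 <ᵇ_) e) , sym (*-identityʳ _)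
⇓double (suc k) σ e with ⇓double k (setReg (setReg σ 1 (reg σ 1 + reg σ 1)) 0 (reg σ 0 ∸ 1)) (cong (_∸ 1) e)
... | t , σ′ , h , r = _ , σ′ , ⇓loop (cong (0 <ᵇ_) e) (⇓seq ⇓reg ⇓reg) h , (begin
  reg σ′ 1                                ≡⟨ r ⟩
  (reg σ 1 + reg σ 1) * 2 ^ k             ≡⟨ cong (λ x → (reg σ 1 + x) * 2 ^ k) (+-identityʳ (reg σ 1)) ⟨
  2 * reg σ 1 * 2 ^ k                     ≡⟨ cong (_* 2 ^ k) (*-comm 2 (reg σ 1)) ⟩
  reg σ 1 * 2 * 2 ^ k                     ≡⟨ *-assoc (reg σ 1) 2 (2 ^ k) ⟩
  reg σ 1 * 2 ^ suc k                     ∎)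
  where open ≡-Reasoning

-- The first run of `double` produces the exponent `2 ^ κ`, which becomes the argument of the
-- second. The factor `C` enters as the starting value of that run.
tower-computable : ∀ C → Computable λ κ → C * 2 ^ 2 ^ κ
tower-computable C = (1 ≔ lit 1 ⨾ double ⨾ 0 ≔ var 1 ⨾ 1 ≔ lit C ⨾ double ⨾ 0 ≔ var 1) , λ κ →
  let _ , σ₁ , h₁ , e₁ = ⇓double κ _ refl
      _ , _ , h₂ , e₂ = ⇓double (2 ^ κ) (setReg (setReg σ₁ 0 (reg σ₁ 1)) 1 C) (trans e₁ (*-identityˡ (2 ^ κ)))
  in _ , _ , ⇓seq ⇓reg (⇓seq h₁ (⇓seq ⇓reg (⇓seq ⇓reg (⇓seq h₂ ⇓reg)))) , e₂

-- Passes from the product in the running time to the sum that is the parameter.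
m*n≤2^[m+n] : ∀ m n → m * n ≤ 2 ^ (m + n)
m*n≤2^[m+n] m n = begin
  m * n           ≤⟨ *-mono-≤ (<⇒≤ (n<2^n m)) (<⇒≤ (n<2^n n)) ⟩
  2 ^ m * 2 ^ n   ≡⟨ ^-distribˡ-+-* 2 m n ⟨
  2 ^ (m + n)     ∎
  where open ≤-Reasoning

n≤∑ : ∀ n (f : Fin n → ℕ) → (∀ j → 0 < f j) → n ≤ ∑ n f
n≤∑ zero    f f>0 = z≤n
n≤∑ (suc n) f f>0 = +-mono-≤ (f>0 zero) (n≤∑ n (λ j → f (suc j)) λ j → f>0 (suc j))

n≤encodingLength : ∀ {m} (I : FlowShop m) → FlowShop.n I ≤ encodingLength I
n≤encodingLength I = ≤-trans (n≤∑ (FlowShop.n I) _ λ _ → s≤s z≤n) (m≤n+m _ _)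

solve-within : (I : FlowShop 2) →
  SolvesWithin (JITFlowShop 2) solve I (unit solve * 4 * (FlowShop.n I * 2 ^ (#d I * #p zero I)))
solve-within I = let run h f opt = runSolve I in
  _ , _ , h , ≤-trans f (≤-reflexive (sym (*-assoc (unit solve) 4 (FlowShop.n I * 2 ^ (#d I * #p zero I))))) , opt

theorem3 : (∃ λ (A : Cmd) → ∃ λ (C : ℕ) → (I : FlowShop 2) →
    SolvesWithin (JITFlowShop 2) A I
    (C * (FlowShop.n I * 2 ^ (#d I * #p zero I))))
    × FPT (JITFlowShop 2) (λ I → #d I + #p zero I)
theorem3 = (solve , C , solve-within) , solve , _ , tower-computable C , 1 , λ I →
  let t , σ , h , t≤ , opt = solve-within I in t , σ , h , ≤-trans t≤ (fpt I) , opt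
  where
  C = unit solve * 4
  fpt : ∀ I → C * (FlowShop.n I * 2 ^ (#d I * #p zero I)) ≤ C * 2 ^ 2 ^ (#d I + #p zero I) * encodingLength I ^ 1
  fpt I = begin
    C * (n * 2 ^ k)                 ≡⟨ cong (C *_) (*-comm n (2 ^ k)) ⟩
    C * (2 ^ k * n)                 ≡⟨ *-assoc C (2 ^ k) n ⟨
    C * 2 ^ k * n                   ≤⟨ *-mono-≤ (*-monoʳ-≤ C (^-monoʳ-≤ 2 (m*n≤2^[m+n] (#d I) (#p zero I))))
                                           (n≤encodingLength I) ⟩
    C * 2 ^ 2 ^ κ * encodingLength I        ≡⟨ cong (C * 2 ^ 2 ^ κ *_) (*-identityʳ (encodingLength I)) ⟨
    C * 2 ^ 2 ^ κ * encodingLength I ^ 1    ∎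
    where
    open ≤-Reasoning
    n = FlowShop.n I
    k = #d I * #p zero I
    κ = #d I + #p zero I
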